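{- Let $n\ge 3$, $d=\lfloor n/2\rfloor$, and let $c_1,\dots,c_d\ge 0$ be the stripe costs of a symmetric circulant TSP instance on $K_n$, with stripe permutation $\phi$, $g$-sequence $g=g^{\phi}$, and $\ell=\min\{i:1\le i\le d,\ g_i=1\}$. Let $\mathrm{LPOPT}$ be the optimal value of the subtour LP and $$\mathrm{VDV}=\Big(\sum_{i=1}^{\ell}(g_{i-1}-g_i)c_{\phi(i)}\Big)+c_{\phi(\ell)}.$$ Then $\mathrm{VDV}=\mathrm{LPOPT}$. Moreover, an optimal solution $x$ to the subtour LP is obtained by setting, for each $1\le i\le d$ and every edge $e$ of length $\phi(i)$, $$x_e=\begin{cases}\frac{g_{i-1}-g_i}{n}, & i\ne \ell,\ \phi(i)\ne n/2,\\ 2\frac{g_{i-1}-g_i}{n}, & i\ne\ell,\ \phi(i)=n/2,\\ \frac{g_{i-1}}{n}, & i=\ell,\ \phi(i)\ne n/2,\\ 2\frac{g_{i-1}}{n}, & i=\ell,\ \phi(i)=n/2,\end{cases}$$ and $x_e=0$ for edges of length $\phi(i)$ with $i>\ell$.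
   Context: Vertices are $V=[n]=\{1,\dots,n\}$, $E$ is the edge set of $K_n$, and arithmetic on vertices is mod $n$. In a symmetric circulant instance, the cost of edge $\{i,j\}$ depends only on its length $k=\min\{(i-j)\bmod n,(j-i)\bmod n\}\in\{1,\dots,d\}$ and equals $c_k$; the set of edges of length $k$ is the $k$-th stripe. A stripe permutation is a permutation $\phi$ of $[d]$ with $c_{\phi(1)}\le\cdots\le c_{\phi(d)}$. Its $g$-sequence is $g_0=n$ and $g_i=\gcd(\phi(i),g_{i-1})$ for $1\le i\le d$. The subtour LP is: minimize $\sum_{e\in E}c_ex_e$ subject to $\sum_{e\in\delta(v)}x_e=2$ for all $v\in V$, $\sum_{e\in\delta(S)}x_e\ge 2$ for all $\emptyset\ne S\subsetneq V$, and $0\le x_e\le 1$ for all $e\in E$, where $\delta(S)$ is the set of edges with exactly one endpoint in $S$ and $\delta(v)=\delta(\{v\})$.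
   Formalization: The stripe costs and the variables of the subtour LP are taken to be rational numbers instead of real numbers, so optimality is stated among rational feasible solutions for rational costs. -}

module Defs where

open import Data.Nat as ℕ using (ℕ; zero; suc; _∸_; _⊓_; _≤ᵇ_; _<ᵇ_; _≡ᵇ_; NonZero)
open import Data.Nat.GCD using (gcd)
open import Data.Integer as ℤ using (ℤ; +_)
open import Data.Rational using (ℚ; _/_; 0ℚ; 1ℚ; _+_; _*_; _≤_)
open import Data.Fin using (Fin; toℕ)
open import Data.Bool using (Bool; true; false; if_then_else_; _∧_; not)
open import Data.Product using (_×_; ∃)
open import Relation.Binary.PropositionalEquality using (_≡_)

sumFin : (m : ℕ) → (Fin m → ℚ) → ℚ
sumFin zero    f = 0ℚ
sumFin (suc m) f = f Fin.zero + sumFin m (λ i → f (Fin.suc i))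
  where import Data.Fin as Fin

sumTo : ℕ → (ℕ → ℚ) → ℚ
sumTo zero    f = 0ℚ
sumTo (suc k) f = sumTo k f + f (suc k)

2ℚ : ℚ
2ℚ = + 2 / 1

ℕtoℚ : ℕ → ℚ
ℕtoℚ a = + a / 1

diffℚ : ℕ → ℕ → ℚ
diffℚ a b = (+ a ℤ.- + b) / 1

-- length of edge {u,v} in K_n: min((u-v) mod n, (v-u) mod n)
edgeLen : (n : ℕ) → Fin n → Fin n → ℕ
edgeLen n u v =
  let a = toℕ u ; b = toℕ v
      dist = if a ≤ᵇ b then b ∸ a else a ∸ b
  in dist ⊓ (n ∸ dist)

-- An LP vector x is a function Fin n → Fin n → ℚ whose entry x u v with
-- toℕ u < toℕ v is the value x_e of the edge e = {u,v}; other entries are ignored.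
edgeVal : {n : ℕ} → (Fin n → Fin n → ℚ) → Fin n → Fin n → ℚ
edgeVal x u v = if toℕ u <ᵇ toℕ v then x u v else x v u

cost : (n : ℕ) → (ℕ → ℚ) → (Fin n → Fin n → ℚ) → ℚ
cost n c x = sumFin n (λ u → sumFin n (λ v →
  if toℕ u <ᵇ toℕ v then c (edgeLen n u v) * x u v else 0ℚ))

degree : (n : ℕ) → (Fin n → Fin n → ℚ) → Fin n → ℚ
degree n x v = sumFin n (λ u → if toℕ u ≡ᵇ toℕ v then 0ℚ else edgeVal x u v)

cut : (n : ℕ) → (Fin n → Fin n → ℚ) → (Fin n → Bool) → ℚ
cut n x S = sumFin n (λ u → sumFin n (λ v →
  if S u ∧ not (S v) then edgeVal x u v else 0ℚ))

SubtourFeasible : (n : ℕ) → (Fin n → Fin n → ℚ) → Set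
SubtourFeasible n x =
  (∀ (v : Fin n) → degree n x v ≡ 2ℚ) ×
  (∀ (S : Fin n → Bool) → ∃ (λ v → S v ≡ true) → ∃ (λ v → S v ≡ false) →
     2ℚ ≤ cut n x S) ×
  (∀ (u v : Fin n) → toℕ u ℕ.< toℕ v → (0ℚ ≤ x u v) × (x u v ≤ 1ℚ))

gSeq : ℕ → (ℕ → ℕ) → ℕ → ℕ
gSeq n φ zero    = n
gSeq n φ (suc i) = gcd (φ (suc i)) (gSeq n φ i)

VDV : ℕ → (ℕ → ℚ) → (ℕ → ℕ) → ℕ → ℚ
VDV n c φ ℓ =
  sumTo ℓ (λ i → diffℚ (gSeq n φ (i ∸ 1)) (gSeq n φ i) * c (φ i)) + c (φ ℓ)

-- the (largest, hence unique for a permutation) i ∈ [1,d] with φ(i) = k; 0 if none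
stripeIndex : ℕ → (ℕ → ℕ) → ℕ → ℕ
stripeIndex zero    φ k = 0
stripeIndex (suc i) φ k = if φ (suc i) ≡ᵇ k then suc i else stripeIndex i φ k

xValue : (n : ℕ) .{{_ : NonZero n}} → (ℕ → ℕ) → ℕ → ℕ → ℚ
xValue n φ ℓ zero = 0ℚ
xValue n φ ℓ (suc j) =
  let i = suc j
      g = gSeq n φ
      half = if (φ i ℕ.* 2) ≡ᵇ n then 2ℚ else 1ℚ
  in if i <ᵇ ℓ then half * ((+ g j ℤ.- + g i) / n)
     else if i ≡ᵇ ℓ then half * (+ g j / n)
     else 0ℚ

xSol : (n : ℕ) .{{_ : NonZero n}} → (ℕ → ℕ) → ℕ → Fin n → Fin n → ℚ
xSol n φ ℓ u v = xValue n φ ℓ (stripeIndex (n ℕ./ 2) φ (edgeLen n u v))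

{-# OPTIONS --safe #-}

-- Let g_i be the g-sequence and H_i the subgroup g_i ℤ/n generated by φ(1), …, φ(i).
-- Feasibility of x: summing over vertices, the cut of S is (2/n) (Σ_{i<ℓ} (g_{i-1} - g_i) ∂_i + g_{ℓ-1} ∂_ℓ), where
-- ∂_k counts the vertices v ∈ S with v + φ(k) ∉ S. Each coset of H_{ℓ-1} has a spanning arborescence with
-- (g_{i-1} - g_i) / g_{ℓ-1} edges of stripe φ(i), oriented away from or towards its root. Going along stripe φ(ℓ) from
-- a vertex of S to one outside S, one finds consecutive cosets A, B of H_{ℓ-1} such that A meets S and B is not contained
-- in S. Joining an in-arborescence of A to an out-arborescence of B by a stripe-φ(ℓ) edge, every translate along H_{ℓ-1}
-- leads from S out of S; counting exits over all n / g_{ℓ-1} translates bounds the bracket below by n.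
-- Optimality: c(φ(i)) - c(φ(1)) is the sum of the increments c(φ(m+1)) - c(φ(m)) over m < i, and an edge joining distinct
-- residue classes mod g_m has stripe index > m. In any feasible y such edges have total weight at least g_m, as each of the
-- g_m classes is a cut of weight ≥ 2. Summation by parts turns the resulting bound into VDV.
module Submission where

open import Defs
open import Data.Nat as ℕ using (ℕ; zero; suc; NonZero; _⊓_; _∸_; _≤ᵇ_; _<ᵇ_; _≡ᵇ_; ∣_-_∣)
open import Data.Rational as ℚ using (ℚ; 0ℚ; 1ℚ; ½; _+_; _*_; -_; _-_; _≤_; _/_; fromℚᵘ)
import Data.Nat.Properties as ℕₚ
open import Data.Nat.Tactic.RingSolver using (solve-∀)
open import Data.Nat.DivMod as DivMod using (m≡m%n+[m/n]*n; m%n<n; _mod_; [m+n]%n≡m%n; m<n⇒m%n≡m)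
open import Data.Nat.Divisibility using (_∣_; divides; quotient; ∣-trans; ∣-refl; ∣⇒≤; m%n≡0⇒n∣m; ∣1⇒≡1; ∣m+n∣m⇒∣n)
open import Data.Nat.GCD using (gcd; gcd[m,n]∣m; gcd[m,n]∣n; gcd-GCD; module Bézout; gcd[m,n]≢0; gcd-greatest)
open import Data.Rational.Properties
open import Data.Rational.Solver using (module +-*-Solver)
import Data.Rational.Unnormalised as ℚᵘ
import Data.Rational.Unnormalised.Properties as ℚᵘₚ
import Data.Integer.Properties as ℤₚ
import Data.Integer as ℤ
open import Data.Fin as Fin using (Fin; toℕ; fromℕ<; punchOut)
open import Data.Fin.Properties as Finₚ using (toℕ<n; fromℕ<-cong; fromℕ<-toℕ; toℕ-fromℕ<; toℕ-injective; any?; punchOut-injective; injective⇒≤)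
open import Data.Fin.Permutation using (permutation)
open import Data.Bool using (Bool; true; false; if_then_else_; _∧_; not)
open import Data.Product using (_×_; _,_; ∃; ∃₂; proj₁; proj₂)
open import Data.Sum using (inj₁; inj₂)
open import Function using (_∘_)
open import Function.Definitions using (Injective)
open import Relation.Nullary using (¬_; Reflects; contradiction; yes; no; ofʸ; ofⁿ; proof)
open import Relation.Binary.PropositionalEquality
open import Algebra.Properties.CommutativeMonoid.Sum +-0-commutativeMonoid using (sum; ∑-distrib-+; ∑-comm; sum-permute)

open +-*-Solver using (solve; _:=_; _:+_; _:*_; _:-_; :-_; con)

-- Arithmetic of the embeddings of ℕ and ℤ into ℚ

-- Operations of ℚ normalise by a gcd and do not compute on variables. A quotient `i / suc n` is by
-- definition `fromℚᵘ` of an unnormalised fraction, so identities are checked there and carried over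
-- by this homomorphism.
fromℚᵘ-homo-+ : ∀ p q → fromℚᵘ (p ℚᵘ.+ q) ≡ fromℚᵘ p + fromℚᵘ q
fromℚᵘ-homo-+ p q = toℚᵘ-injective (ℚᵘₚ.≃-trans (toℚᵘ-fromℚᵘ (p ℚᵘ.+ q))
  (ℚᵘₚ.≃-sym (ℚᵘₚ.≃-trans (toℚᵘ-homo-+ (fromℚᵘ p) (fromℚᵘ q)) (ℚᵘₚ.+-cong (toℚᵘ-fromℚᵘ p) (toℚᵘ-fromℚᵘ q)))))

fromℚᵘ-homo-* : ∀ p q → fromℚᵘ (p ℚᵘ.* q) ≡ fromℚᵘ p * fromℚᵘ q
fromℚᵘ-homo-* p q = toℚᵘ-injective (ℚᵘₚ.≃-trans (toℚᵘ-fromℚᵘ (p ℚᵘ.* q))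
  (ℚᵘₚ.≃-sym (ℚᵘₚ.≃-trans (toℚᵘ-homo-* (fromℚᵘ p) (fromℚᵘ q)) (ℚᵘₚ.*-cong (toℚᵘ-fromℚᵘ p) (toℚᵘ-fromℚᵘ q)))))

/1-homo-+ : ∀ i j → (i ℤ.+ j) / 1 ≡ i / 1 + j / 1
/1-homo-+ i j = trans (cong₂ (λ a b → (a ℤ.+ b) / 1) (sym (ℤₚ.*-identityʳ i)) (sym (ℤₚ.*-identityʳ j)))
  (fromℚᵘ-homo-+ (ℚᵘ.mkℚᵘ i 0) (ℚᵘ.mkℚᵘ j 0))

/1-homo-* : ∀ i j → (i ℤ.* j) / 1 ≡ i / 1 * (j / 1)
/1-homo-* i j = fromℚᵘ-homo-* (ℚᵘ.mkℚᵘ i 0) (ℚᵘ.mkℚᵘ j 0)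

ℕtoℚ-homo-+ : ∀ a b → ℕtoℚ (a ℕ.+ b) ≡ ℕtoℚ a + ℕtoℚ b
ℕtoℚ-homo-+ a b = trans (cong (_/ 1) (ℤₚ.pos-+ a b)) (/1-homo-+ (ℤ.+ a) (ℤ.+ b))

ℕtoℚ-homo-* : ∀ a b → ℕtoℚ (a ℕ.* b) ≡ ℕtoℚ a * ℕtoℚ b
ℕtoℚ-homo-* a b = trans (cong (_/ 1) (ℤₚ.pos-* a b)) (/1-homo-* (ℤ.+ a) (ℤ.+ b))

ℕtoℚ-suc : ∀ a → ℕtoℚ (suc a) ≡ 1ℚ + ℕtoℚ a
ℕtoℚ-suc a = ℕtoℚ-homo-+ 1 a

0≤ℕtoℚ : ∀ a → 0ℚ ≤ ℕtoℚ a
0≤ℕtoℚ a = nonNegative⁻¹ (ℕtoℚ a) {{normalize-nonNeg a 1}}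

/≡*1/ : ∀ i n .{{_ : NonZero n}} → i / n ≡ (i / 1) * (ℤ.+ 1 / n)
/≡*1/ i (suc n) = trans (fromℚᵘ-cong {ℚᵘ.mkℚᵘ i n} {ℚᵘ.mkℚᵘ i 0 ℚᵘ.* ℚᵘ.mkℚᵘ (ℤ.+ 1) n} (ℚᵘ.*≡* (cong₂ ℤ._*_ (sym (ℤₚ.*-identityʳ i)) (cong ℤ.+_ (ℕₚ.+-identityʳ (suc n))))))
  (fromℚᵘ-homo-* (ℚᵘ.mkℚᵘ i 0) (ℚᵘ.mkℚᵘ (ℤ.+ 1) n))

ℕtoℚ*1/ : ∀ n .{{_ : NonZero n}} → ℕtoℚ n * (ℤ.+ 1 / n) ≡ 1ℚ
ℕtoℚ*1/ n@(suc _) = trans (sym (/≡*1/ (ℤ.+ n) n)) (fromℚᵘ-cong {ℚᵘ.mkℚᵘ (ℤ.+ n) _} {ℚᵘ.mkℚᵘ (ℤ.+ 1) 0} (ℚᵘ.*≡* (ℤₚ.*-comm (ℤ.+ n) (ℤ.+ 1))))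

0≤1/ : ∀ n .{{_ : NonZero n}} → 0ℚ ≤ ℤ.+ 1 / n
0≤1/ n = nonNegative⁻¹ (ℤ.+ 1 / n) {{normalize-nonNeg 1 n}}

/1-homo-neg : ∀ i → (ℤ.- i) / 1 ≡ - (i / 1)
/1-homo-neg i = trans (solve 2 (λ x y → x := (x :+ y) :- y) refl ((ℤ.- i) / 1) (i / 1))
  (trans (cong (_- i / 1) (trans (sym (/1-homo-+ (ℤ.- i) i)) (cong (_/ 1) (ℤₚ.+-inverseˡ i)))) (+-identityˡ _))

diffℚ≡ : ∀ a b → diffℚ a b ≡ ℕtoℚ a - ℕtoℚ b
diffℚ≡ a b = trans (/1-homo-+ (ℤ.+ a) (ℤ.- ℤ.+ b)) (cong (_+_ (ℕtoℚ a)) (/1-homo-neg (ℤ.+ b)))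

0≤*0≤ : ∀ {p q} → 0ℚ ≤ p → 0ℚ ≤ q → 0ℚ ≤ p * q
0≤*0≤ {p} {q} a b = nonNegative⁻¹ (p * q) {{nonNeg*nonNeg⇒nonNeg p {{ℚ.nonNegative a}} q {{ℚ.nonNegative b}}}}

*-monoˡ-≤ : ∀ {r p q} → 0ℚ ≤ r → p ≤ q → r * p ≤ r * q
*-monoˡ-≤ {r} 0≤r = *-monoˡ-≤-nonNeg r {{ℚ.nonNegative 0≤r}}

0≤q-p⇒p≤q : ∀ {p q} → 0ℚ ≤ q - p → p ≤ q
0≤q-p⇒p≤q {p} {q} h = subst₂ _≤_ (+-identityˡ p) (solve 2 (λ p q → (q :- p) :+ p := q) refl p q) (+-monoˡ-≤ p h)

p≤q⇒0≤q-p : ∀ {p q} → p ≤ q → 0ℚ ≤ q - p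
p≤q⇒0≤q-p {p} {q} h = subst (_≤ q - p) (+-inverseʳ p) (+-monoˡ-≤ (- p) h)

ℕtoℚ-mono-≤ : ∀ {a b} → a ℕ.≤ b → ℕtoℚ a ≤ ℕtoℚ b
ℕtoℚ-mono-≤ {a} {b} a≤b = 0≤q-p⇒p≤q (subst (0ℚ ≤_)
  (trans (solve 2 (λ x y → y := (x :+ y) :- x) refl (ℕtoℚ a) (ℕtoℚ (b ℕ.∸ a)))
    (cong (_- ℕtoℚ a) (trans (sym (ℕtoℚ-homo-+ a (b ℕ.∸ a))) (cong ℕtoℚ (ℕₚ.m+[n∸m]≡n a≤b)))))
  (0≤ℕtoℚ (b ℕ.∸ a)))

0≤+0≤ : ∀ {p q} → 0ℚ ≤ p → 0ℚ ≤ q → 0ℚ ≤ p + q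
0≤+0≤ {p} {q} a b = subst (_≤ p + q) (+-identityˡ 0ℚ) (+-mono-≤ a b)

p≤p+q : ∀ {p q} → 0ℚ ≤ q → p ≤ p + q
p≤p+q {p} {q} h = subst (_≤ p + q) (+-identityʳ p) (+-monoʳ-≤ p h)

p≤q+p : ∀ {p q} → 0ℚ ≤ q → p ≤ q + p
p≤q+p {p} {q} h = subst (_≤ q + p) (+-identityˡ p) (+-monoˡ-≤ p h)

-- Finite sums

sumFin≡sum : ∀ {m} (f : Fin m → ℚ) → sumFin m f ≡ sum f
sumFin≡sum {zero}  f = refl
sumFin≡sum {suc m} f = cong (f Fin.zero +_) (sumFin≡sum (f ∘ Fin.suc))

sumFin-cong : ∀ {m} {f g : Fin m → ℚ} → (∀ i → f i ≡ g i) → sumFin m f ≡ sumFin m g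
sumFin-cong {zero}  h = refl
sumFin-cong {suc m} h = cong₂ _+_ (h Fin.zero) (sumFin-cong (h ∘ Fin.suc))

sumFin-mono : ∀ {m} {f g : Fin m → ℚ} → (∀ i → f i ≤ g i) → sumFin m f ≤ sumFin m g
sumFin-mono {zero}  h = ≤-refl
sumFin-mono {suc m} h = +-mono-≤ (h Fin.zero) (sumFin-mono (h ∘ Fin.suc))

sumFin-+ : ∀ {m} (f g : Fin m → ℚ) → sumFin m (λ i → f i + g i) ≡ sumFin m f + sumFin m g
sumFin-+ f g = trans (sumFin≡sum (λ i → f i + g i))
  (trans (∑-distrib-+ f g) (sym (cong₂ _+_ (sumFin≡sum f) (sumFin≡sum g))))

sumFin-* : ∀ {m} x (f : Fin m → ℚ) → sumFin m (λ i → x * f i) ≡ x * sumFin m f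
sumFin-* {zero}  x f = sym (*-zeroʳ x)
sumFin-* {suc m} x f = trans (cong (x * f Fin.zero +_) (sumFin-* x (f ∘ Fin.suc))) (sym (*-distribˡ-+ x _ _))

sumFin-const : ∀ m x → sumFin m (λ _ → x) ≡ ℕtoℚ m * x
sumFin-const zero    x = sym (*-zeroˡ x)
sumFin-const (suc m) x = trans (cong (x +_) (sumFin-const m x))
  (trans (solve 2 (λ x k → x :+ k :* x := (con 1ℚ :+ k) :* x) refl x (ℕtoℚ m)) (cong (_* x) (sym (ℕtoℚ-suc m))))

sumFin-zero : ∀ m → sumFin m (λ _ → 0ℚ) ≡ 0ℚ
sumFin-zero m = trans (sumFin-const m 0ℚ) (*-zeroʳ (ℕtoℚ m))

sumFin-swap : ∀ {m n} (f : Fin m → Fin n → ℚ) →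
  sumFin m (λ i → sumFin n (f i)) ≡ sumFin n (λ j → sumFin m (λ i → f i j))
sumFin-swap f = trans (sumFin≡sum² f) (trans (∑-comm f) (sym (sumFin≡sum² (λ j i → f i j))))
  where
  sumFin≡sum² : ∀ {m n} (f : Fin m → Fin n → ℚ) → sumFin m (λ i → sumFin n (f i)) ≡ sum (λ i → sum (f i))
  sumFin≡sum² f = trans (sumFin-cong (λ i → sumFin≡sum (f i))) (sumFin≡sum (λ i → sum (f i)))

sumFin-nonneg : ∀ {m} {f : Fin m → ℚ} → (∀ i → 0ℚ ≤ f i) → 0ℚ ≤ sumFin m f
sumFin-nonneg {m} {f} h = subst (_≤ sumFin m f) (sumFin-zero m) (sumFin-mono h)

-- The summand lives on all of ℕ, so that translates `h (v + k)` make sense without reducing mod n;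
-- functions on ℤ/n are represented by functions of period n.
∑ : ℕ → (ℕ → ℚ) → ℚ
∑ m h = sumFin m (h ∘ toℕ)

∑-cong< : ∀ m {f g : ℕ → ℚ} → (∀ i → i ℕ.< m → f i ≡ g i) → ∑ m f ≡ ∑ m g
∑-cong< zero    h = refl
∑-cong< (suc m) h = cong₂ _+_ (h 0 ℕ.z<s) (∑-cong< m (λ i i<m → h (suc i) (ℕ.s<s i<m)))

∑-cong : ∀ m {f g : ℕ → ℚ} → (∀ i → f i ≡ g i) → ∑ m f ≡ ∑ m g
∑-cong m h = ∑-cong< m (λ i _ → h i)

∑-append : ∀ a b (f : ℕ → ℚ) → ∑ (a ℕ.+ b) f ≡ ∑ a f + ∑ b (λ i → f (a ℕ.+ i))
∑-append zero    b f = sym (+-identityˡ _)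
∑-append (suc a) b f = trans (cong (f 0 +_) (∑-append a b (f ∘ suc))) (sym (+-assoc (f 0) _ _))

∑-last : ∀ m (f : ℕ → ℚ) → ∑ (suc m) f ≡ ∑ m f + f m
∑-last zero    f = +-comm (f 0) 0ℚ
∑-last (suc m) f = trans (cong (f 0 +_) (∑-last m (f ∘ suc))) (sym (+-assoc (f 0) _ _))

sumTo≡∑ : ∀ k (f : ℕ → ℚ) → sumTo k f ≡ ∑ k (f ∘ suc)
sumTo≡∑ zero    f = refl
sumTo≡∑ (suc k) f = trans (cong (_+ f (suc k)) (sumTo≡∑ k f)) (sym (∑-last k (f ∘ suc)))

∑-reverse : ∀ m (f : ℕ → ℚ) → ∑ m (λ i → f (m ℕ.∸ suc i)) ≡ ∑ m f
∑-reverse zero    f = refl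
∑-reverse (suc m) f = trans (cong (f m +_) (∑-reverse m f)) (trans (+-comm (f m) _) (sym (∑-last m f)))

∑-term : ∀ {m} {f : ℕ → ℚ} → (∀ i → 0ℚ ≤ f i) → ∀ i → i ℕ.< m → f i ≤ ∑ m f
∑-term {suc m} h zero    _ = p≤p+q (sumFin-nonneg {m} (λ i → h (suc (toℕ i))))
∑-term {suc m} h (suc i) (ℕ.s≤s lt) = ≤-trans (∑-term {m} (h ∘ suc) i lt) (p≤q+p (h 0))

∑-prefix : ∀ {a b} {f : ℕ → ℚ} → (∀ i → 0ℚ ≤ f i) → a ℕ.≤ b → ∑ a f ≤ ∑ b f
∑-prefix {a} {b} {f} h a≤b = subst (λ m → ∑ a f ≤ ∑ m f) (ℕₚ.m+[n∸m]≡n a≤b)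
  (subst (∑ a f ≤_) (sym (∑-append a (b ℕ.∸ a) f)) (p≤p+q (sumFin-nonneg {b ℕ.∸ a} (λ i → h (a ℕ.+ toℕ i)))))

-- Congruences and sums over cosets

infix 4 _≅_[_]
-- Congruence mod g with a natural multiple of g on either side: no subtraction occurs, and
-- consequences are polynomial identities over ℕ.
_≅_[_] : ℕ → ℕ → ℕ → Set
v ≅ w [ g ] = ∃₂ λ a b → v ℕ.+ a ℕ.* g ≡ w ℕ.+ b ℕ.* g

bézout-≅ : ∀ m G .{{_ : NonZero G}} → ∃ λ x → x ℕ.* m ≅ gcd m G [ G ]
bézout-≅ m G@(suc G-1) with Bézout.identity (gcd-GCD m G)
... | Bézout.+- x y eq = x , 0 , y , trans (ℕₚ.+-identityʳ (x ℕ.* m)) (sym eq)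
-- Here d + x m = y G, so the coefficient wanted is -x; x (G - 1) is a natural number congruent to
-- it mod G.
... | Bézout.-+ x y eq = x ℕ.* G-1 , y , x ℕ.* m , (begin
  x ℕ.* G-1 ℕ.* m ℕ.+ y ℕ.* G             ≡⟨ cong (x ℕ.* G-1 ℕ.* m ℕ.+_) eq ⟨
  x ℕ.* G-1 ℕ.* m ℕ.+ (d ℕ.+ x ℕ.* m)     ≡⟨ lemma x G-1 m d ⟩
  d ℕ.+ x ℕ.* m ℕ.* G                     ∎)
  where
  open ≡-Reasoning
  d = gcd m G
  lemma : ∀ x k m d → x ℕ.* k ℕ.* m ℕ.+ (d ℕ.+ x ℕ.* m) ≡ d ℕ.+ x ℕ.* m ℕ.* suc k
  lemma = solve-∀

-- A residue class mod gcd m G splits into the classes of v, v + m, …, v + (r − 1) m mod G, where r = G / gcd m G.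
≅-gcd : ∀ m G .{{_ : NonZero G}} {v w} → v ≅ w [ gcd m G ] →
  ∃ λ k → k ℕ.< quotient (gcd[m,n]∣n m G) × v ℕ.+ k ℕ.* m ≅ w [ G ]
≅-gcd m G {v} {w} (b , a , v+bg≡w+ag) with gcd[m,n]∣m m G | gcd[m,n]∣n m G | bézout-≅ m G
... | divides f m≡fg | divides zero G≡0 | _ = contradiction G≡0 (ℕ.≢-nonZero⁻¹ G)
... | divides f m≡fg | divides r@(suc r-1) G≡rg | x , a′ , b′ , bez =
  k , m%n<n (s ℕ.* x) r , q ℕ.* f ℕ.+ s ℕ.* a′ , a ℕ.+ s ℕ.* b′ , (begin
  v ℕ.+ k ℕ.* m ℕ.+ (q ℕ.* f ℕ.+ s ℕ.* a′) ℕ.* G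
    ≡⟨ e₁ v k m q f s a′ G ⟩
  v ℕ.+ (k ℕ.* m ℕ.+ q ℕ.* f ℕ.* G) ℕ.+ s ℕ.* a′ ℕ.* G
    ≡⟨ cong (λ z → v ℕ.+ z ℕ.+ s ℕ.* a′ ℕ.* G) km ⟩
  v ℕ.+ s ℕ.* x ℕ.* m ℕ.+ s ℕ.* a′ ℕ.* G
    ≡⟨ e₂ v s x m a′ G ⟩
  v ℕ.+ s ℕ.* (x ℕ.* m ℕ.+ a′ ℕ.* G)
    ≡⟨ cong (λ z → v ℕ.+ s ℕ.* z) bez ⟩
  v ℕ.+ s ℕ.* (g ℕ.+ b′ ℕ.* G)
    ≡⟨ e₃ v b a r-1 g b′ G ⟩
  (v ℕ.+ b ℕ.* g) ℕ.+ a ℕ.* r-1 ℕ.* g ℕ.+ s ℕ.* b′ ℕ.* G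
    ≡⟨ cong (λ z → z ℕ.+ a ℕ.* r-1 ℕ.* g ℕ.+ s ℕ.* b′ ℕ.* G) v+bg≡w+ag ⟩
  (w ℕ.+ a ℕ.* g) ℕ.+ a ℕ.* r-1 ℕ.* g ℕ.+ s ℕ.* b′ ℕ.* G
    ≡⟨ e₄ w a r-1 g (s ℕ.* b′ ℕ.* G) ⟩
  w ℕ.+ a ℕ.* (suc r-1 ℕ.* g) ℕ.+ s ℕ.* b′ ℕ.* G
    ≡⟨ cong (λ z → w ℕ.+ a ℕ.* z ℕ.+ s ℕ.* b′ ℕ.* G) G≡rg ⟨
  w ℕ.+ a ℕ.* G ℕ.+ s ℕ.* b′ ℕ.* G
    ≡⟨ e₅ w a s b′ G ⟩
  w ℕ.+ (a ℕ.+ s ℕ.* b′) ℕ.* G ∎)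
  where
  open ≡-Reasoning
  g = gcd m G
  -- From v + b g = w + a g, w - v is (b - a) g, and `s` is a natural number congruent to b - a mod
  -- r. Since x m ≅ g, going s x steps of m from v reaches w mod G. Reducing s x mod r drops q r m =
  -- q f G, a multiple of G.
  s = b ℕ.+ a ℕ.* r-1
  k = (s ℕ.* x) DivMod.% r
  q = (s ℕ.* x) DivMod./ r
  e₁ : ∀ v k m q f s a G → v ℕ.+ k ℕ.* m ℕ.+ (q ℕ.* f ℕ.+ s ℕ.* a) ℕ.* G ≡ v ℕ.+ (k ℕ.* m ℕ.+ q ℕ.* f ℕ.* G) ℕ.+ s ℕ.* a ℕ.* G
  e₁ = solve-∀
  e₂ : ∀ v s x m a G → v ℕ.+ s ℕ.* x ℕ.* m ℕ.+ s ℕ.* a ℕ.* G ≡ v ℕ.+ s ℕ.* (x ℕ.* m ℕ.+ a ℕ.* G)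
  e₂ = solve-∀
  e₃ : ∀ v b a r g b′ G → v ℕ.+ (b ℕ.+ a ℕ.* r) ℕ.* (g ℕ.+ b′ ℕ.* G) ≡ (v ℕ.+ b ℕ.* g) ℕ.+ a ℕ.* r ℕ.* g ℕ.+ (b ℕ.+ a ℕ.* r) ℕ.* b′ ℕ.* G
  e₃ = solve-∀
  e₄ : ∀ w a r g z → (w ℕ.+ a ℕ.* g) ℕ.+ a ℕ.* r ℕ.* g ℕ.+ z ≡ w ℕ.+ a ℕ.* (suc r ℕ.* g) ℕ.+ z
  e₄ = solve-∀
  e₅ : ∀ w a s b G → w ℕ.+ a ℕ.* G ℕ.+ s ℕ.* b ℕ.* G ≡ w ℕ.+ (a ℕ.+ s ℕ.* b) ℕ.* G
  e₅ = solve-∀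
  e₆ : ∀ q f r g → q ℕ.* f ℕ.* (r ℕ.* g) ≡ q ℕ.* r ℕ.* (f ℕ.* g)
  e₆ = solve-∀
  km : k ℕ.* m ℕ.+ q ℕ.* f ℕ.* G ≡ s ℕ.* x ℕ.* m
  km = begin
    k ℕ.* m ℕ.+ q ℕ.* f ℕ.* G            ≡⟨ cong (λ z → k ℕ.* m ℕ.+ q ℕ.* f ℕ.* z) G≡rg ⟩
    k ℕ.* m ℕ.+ q ℕ.* f ℕ.* (r ℕ.* g)    ≡⟨ cong (k ℕ.* m ℕ.+_) (e₆ q f r g) ⟩
    k ℕ.* m ℕ.+ q ℕ.* r ℕ.* (f ℕ.* g)    ≡⟨ cong (λ z → k ℕ.* m ℕ.+ q ℕ.* r ℕ.* z) m≡fg ⟨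
    k ℕ.* m ℕ.+ q ℕ.* r ℕ.* m            ≡⟨ ℕₚ.*-distribʳ-+ m k (q ℕ.* r) ⟨
    (k ℕ.+ q ℕ.* r) ℕ.* m                ≡⟨ cong (ℕ._* m) (m≡m%n+[m/n]*n (s ℕ.* x) r) ⟨
    s ℕ.* x ℕ.* m                        ∎

Periodic : ℕ → (ℕ → ℚ) → Set
Periodic n h = ∀ v → h (v ℕ.+ n) ≡ h v

periodic-* : ∀ {n h} → Periodic n h → ∀ v a → h (v ℕ.+ a ℕ.* n) ≡ h v
periodic-* {n} {h} per v zero    = cong h (ℕₚ.+-identityʳ v)
periodic-* {n} {h} per v (suc a) = trans (cong h (lemma v n (a ℕ.* n))) (trans (per (v ℕ.+ a ℕ.* n)) (periodic-* per v a))
  where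
  lemma : ∀ v n x → v ℕ.+ (n ℕ.+ x) ≡ v ℕ.+ x ℕ.+ n
  lemma = solve-∀

periodic-≅ : ∀ {n h} → Periodic n h → ∀ {v w} → v ≅ w [ n ] → h v ≡ h w
periodic-≅ {n} {h} per {v} {w} (a , b , e) = trans (sym (periodic-* per v a)) (trans (cong h e) (periodic-* per w b))

periodic-shift : ∀ {n h} → Periodic n h → ∀ k → Periodic n (λ v → h (v ℕ.+ k))
periodic-shift {n} {h} per k v = trans (cong h (lemma v n k)) (per (v ℕ.+ k))
  where
  lemma : ∀ v n k → v ℕ.+ n ℕ.+ k ≡ v ℕ.+ k ℕ.+ n
  lemma = solve-∀

-- Shifting by one exchanges the first term for the one n places later, which is equal by
-- periodicity.
∑-shift : ∀ {n h} → Periodic n h → ∀ k → ∑ n (λ v → h (v ℕ.+ k)) ≡ ∑ n h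
∑-shift {n} {h} per zero    = ∑-cong n (λ v → cong h (ℕₚ.+-identityʳ v))
∑-shift {n} {h} per (suc k) = begin
  ∑ n (λ v → h (v ℕ.+ suc k))  ≡⟨ ∑-cong n (λ v → cong h (ℕₚ.+-suc v k)) ⟩
  ∑ n (h′ ∘ suc)               ≡⟨ rotate ⟩
  ∑ n h′                       ≡⟨ ∑-shift {n} {h} per k ⟩
  ∑ n h                        ∎
  where
  open ≡-Reasoning
  h′ : ℕ → ℚ
  h′ v = h (v ℕ.+ k)
  rotate : ∑ n (h′ ∘ suc) ≡ ∑ n h′
  rotate = begin
    ∑ n (h′ ∘ suc)                        ≡⟨ solve 2 (λ x y → y := (x :+ y) :- x) refl (h′ 0) _ ⟩
    (h′ 0 + ∑ n (h′ ∘ suc)) - h′ 0        ≡⟨ cong (_- h′ 0) (∑-last n h′) ⟩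
    (∑ n h′ + h′ n) - h′ 0                ≡⟨ cong (λ z → (∑ n h′ + z) - h′ 0) (periodic-shift per k 0) ⟩
    (∑ n h′ + h′ 0) - h′ 0                ≡⟨ solve 2 (λ x y → (y :+ x) :- x := y) refl (h′ 0) _ ⟩
    ∑ n h′                                ∎

-- For M g = n this is the sum over the coset of a modulo the subgroup g ℤ/n, which has M elements.
∑coset : ℕ → ℕ → ℕ → (ℕ → ℚ) → ℚ
∑coset M g a h = ∑ M (λ t → h (a ℕ.+ t ℕ.* g))

∑coset-shift : ∀ M g a {h} → Periodic (M ℕ.* g) h → ∀ q →
  ∑coset M g (a ℕ.+ q ℕ.* g) h ≡ ∑coset M g a h
∑coset-shift M g a {h} per q = trans (∑-cong M (λ t → cong h (lemma a q t g))) (∑-shift per′ q)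
  where
  lemma : ∀ a q t g → a ℕ.+ q ℕ.* g ℕ.+ t ℕ.* g ≡ a ℕ.+ (t ℕ.+ q) ℕ.* g
  lemma = solve-∀
  lemma′ : ∀ a t M g → a ℕ.+ (t ℕ.+ M) ℕ.* g ≡ a ℕ.+ t ℕ.* g ℕ.+ M ℕ.* g
  lemma′ = solve-∀
  per′ : Periodic M (λ t → h (a ℕ.+ t ℕ.* g))
  per′ t = trans (cong h (lemma′ a t M g)) (per (a ℕ.+ t ℕ.* g))

∑coset-translate : ∀ M g a {h} → Periodic (M ℕ.* g) h → ∀ {m} → g ∣ m →
  ∑coset M g a (λ v → h (v ℕ.+ m)) ≡ ∑coset M g a h
∑coset-translate M g a {h} per {m} (divides q refl) =
  trans (∑-cong M (λ t → cong h (lemma a (t ℕ.* g) (q ℕ.* g)))) (∑coset-shift M g a per q)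
  where
  lemma : ∀ a x y → a ℕ.+ x ℕ.+ y ≡ a ℕ.+ y ℕ.+ x
  lemma = solve-∀

-- Writing v = r + t g cuts the range into M blocks of length g; exchanging the two sums groups the
-- terms by residue r.
∑-cosets : ∀ M g (h : ℕ → ℚ) → ∑ (M ℕ.* g) h ≡ ∑ g (λ r → ∑coset M g r h)
∑-cosets M g h = trans (blocks M h) (sumFin-swap {M} {g} (λ t r → h (toℕ r ℕ.+ toℕ t ℕ.* g)))
  where
  lemma : ∀ g r x → g ℕ.+ (r ℕ.+ x) ≡ r ℕ.+ (g ℕ.+ x)
  lemma = solve-∀
  blocks : ∀ M (h : ℕ → ℚ) → ∑ (M ℕ.* g) h ≡ ∑ M (λ t → ∑ g (λ r → h (r ℕ.+ t ℕ.* g)))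
  blocks zero    h = refl
  blocks (suc M) h = trans (∑-append g (M ℕ.* g) h) (cong₂ _+_
    (∑-cong g (λ r → cong h (sym (ℕₚ.+-identityʳ r))))
    (trans (blocks M (λ v → h (g ℕ.+ v))) (∑-cong M (λ t → ∑-cong g (λ r → cong h (lemma g r (t ℕ.* g)))))))

∑-first+term : ∀ {m} {f : ℕ → ℚ} → (∀ i → 0ℚ ≤ f i) → ∀ s → s ≢ 0 → s ℕ.< m → f 0 + f s ≤ ∑ m f
∑-first+term h zero s≢0 _ = contradiction refl s≢0
∑-first+term {suc m} {f} h (suc s) _ (ℕ.s≤s s<m) = +-monoʳ-≤ (f 0) (∑-term {m} (h ∘ suc) s s<m)

∑coset-decompose : ∀ M g a {h} → Periodic (M ℕ.* g) h → ∑ (M ℕ.* g) h ≡ ∑ g (λ r → ∑coset M g (a ℕ.+ r) h)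
∑coset-decompose M g a {h} per = trans (sym (∑-shift per a)) (trans (∑-cosets M g (λ v → h (v ℕ.+ a)))
  (∑-cong g (λ r → ∑-cong M (λ t → cong h (lemma a r (t ℕ.* g))))))
  where
  lemma : ∀ a r x → r ℕ.+ x ℕ.+ a ≡ a ℕ.+ r ℕ.+ x
  lemma = solve-∀

-- In the decomposition into cosets starting from that of a, the coset of a + m is the term at m %
-- g. This differs from the term at 0 as g does not divide m, so the two sums involve disjoint sets
-- of vertices.
two-cosets-≤ : ∀ M g .{{_ : NonZero g}} a {h} → Periodic (M ℕ.* g) h → (∀ v → 0ℚ ≤ h v) → ∀ {m} → ¬ g ∣ m →
  ∑coset M g a h + ∑coset M g (a ℕ.+ m) h ≤ ∑ (M ℕ.* g) h
two-cosets-≤ M g a {h} per h≥0 {m} g∤m = subst₂ _≤_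
  (cong₂ _+_ (cong (λ z → ∑coset M g z h) (ℕₚ.+-identityʳ a))
    (trans (sym (∑coset-shift M g (a ℕ.+ m DivMod.% g) per (m DivMod./ g)))
      (cong (λ z → ∑coset M g z h) (trans (ℕₚ.+-assoc a _ _) (cong (a ℕ.+_) (sym (m≡m%n+[m/n]*n m g)))))))
  (sym (∑coset-decompose M g a per))
  (∑-first+term {g} (λ r → sumFin-nonneg {M} (λ t → h≥0 (a ℕ.+ r ℕ.+ toℕ t ℕ.* g))) (m DivMod.% g) (λ e → g∤m (m%n≡0⇒n∣m m g e)) (m%n<n m g))

coset-≤ : ∀ M g .{{_ : NonZero g}} a {h} → Periodic (M ℕ.* g) h → (∀ v → 0ℚ ≤ h v) →
  ∑coset M g a h ≤ ∑ (M ℕ.* g) h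
coset-≤ M g a {h} per h≥0 = subst₂ _≤_ (cong (λ z → ∑coset M g z h) (ℕₚ.+-identityʳ a)) (sym (∑coset-decompose M g a per))
  (∑-term {g} (λ r → sumFin-nonneg {M} (λ t → h≥0 (a ℕ.+ r ℕ.+ toℕ t ℕ.* g))) 0 (ℕ.>-nonZero⁻¹ g))

-- Cuts of circulant weights

gSeq-nonZero : ∀ n .{{_ : NonZero n}} φ j → NonZero (gSeq n φ j)
gSeq-nonZero n@(suc _) φ zero    = _
gSeq-nonZero n φ (suc j) = ℕ.≢-nonZero
  (gcd[m,n]≢0 (φ (suc j)) (gSeq n φ j) (inj₂ (ℕ.≢-nonZero⁻¹ (gSeq n φ j) {{gSeq-nonZero n φ j}})))

gSeq-∣ : ∀ n φ {i j} → i ℕ.≤ j → gSeq n φ j ∣ gSeq n φ i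
gSeq-∣ n φ {i} {j} i≤j = go (ℕₚ.≤⇒≤′ i≤j)
  where
  go : ∀ {j} → i ℕ.≤′ j → gSeq n φ j ∣ gSeq n φ i
  go ℕ.≤′-refl = ∣-refl
  go (ℕ.≤′-step {j} i≤j) = ∣-trans (gcd[m,n]∣n (φ (suc j)) (gSeq n φ j)) (go i≤j)

gSeq-∣φ : ∀ n φ {i j} → 1 ℕ.≤ i → i ℕ.≤ j → gSeq n φ j ∣ φ i
gSeq-∣φ n φ {suc i} _ i≤j = ∣-trans (gSeq-∣ n φ i≤j) (gcd[m,n]∣m (φ (suc i)) (gSeq n φ i))

gSeq-step-≤ : ∀ n .{{_ : NonZero n}} φ j → gSeq n φ (suc j) ℕ.≤ gSeq n φ j
gSeq-step-≤ n φ j = ∣⇒≤ {{gSeq-nonZero n φ j}} (gcd[m,n]∣n (φ (suc j)) (gSeq n φ j))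

0≤diffℚ : ∀ {a b} → b ℕ.≤ a → 0ℚ ≤ diffℚ a b
0≤diffℚ {a} {b} b≤a = subst (0ℚ ≤_) (sym (diffℚ≡ a b)) (p≤q⇒0≤q-p (ℕtoℚ-mono-≤ b≤a))

sumTo-cong : ∀ k {f g : ℕ → ℚ} → (∀ i → 1 ℕ.≤ i → i ℕ.≤ k → f i ≡ g i) → sumTo k f ≡ sumTo k g
sumTo-cong zero    h = refl
sumTo-cong (suc k) h = cong₂ _+_ (sumTo-cong k (λ i 1≤i i≤k → h i 1≤i (ℕₚ.m≤n⇒m≤1+n i≤k))) (h (suc k) (ℕ.s≤s ℕ.z≤n) ℕₚ.≤-refl)

sumTo-mono : ∀ k {f g : ℕ → ℚ} → (∀ i → 1 ℕ.≤ i → i ℕ.≤ k → f i ≤ g i) → sumTo k f ≤ sumTo k g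
sumTo-mono zero    h = ≤-refl
sumTo-mono (suc k) h = +-mono-≤ (sumTo-mono k (λ i 1≤i i≤k → h i 1≤i (ℕₚ.m≤n⇒m≤1+n i≤k))) (h (suc k) (ℕ.s≤s ℕ.z≤n) ℕₚ.≤-refl)

sumTo-+ : ∀ k (f g : ℕ → ℚ) → sumTo k (λ i → f i + g i) ≡ sumTo k f + sumTo k g
sumTo-+ zero    f g = refl
sumTo-+ (suc k) f g = trans (cong (_+ (f (suc k) + g (suc k))) (sumTo-+ k f g))
  (solve 4 (λ a b c d → (a :+ b) :+ (c :+ d) := (a :+ c) :+ (b :+ d)) refl (sumTo k f) (sumTo k g) (f (suc k)) (g (suc k)))

-- The vertices ≡ v mod gSeq j form an out-arborescence rooted at v, assembled from translates of the previous
-- one along a path of stripe-φ (suc j) edges; treeExits j v is its total δ-weight. A step from u to v costs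
-- δ u v ≥ p u - p v, so the path from the root to w pays for p v - p w.
module Arborescence (n : ℕ) .{{_ : NonZero n}} (φ : ℕ → ℕ) (p : ℕ → ℚ) (δ : ℕ → ℕ → ℚ)
  (p-periodic : Periodic n p) (δ-periodic : ∀ u v → δ (u ℕ.+ n) (v ℕ.+ n) ≡ δ u v)
  (0≤δ : ∀ u v → 0ℚ ≤ δ u v) (p≤δ+p : ∀ u v → p u ≤ δ u v + p v) where

  g : ℕ → ℕ
  g = gSeq n φ

  ratio : ℕ → ℕ
  ratio j = quotient (gcd[m,n]∣n (φ (suc j)) (g j))

  step : ℕ → ℕ → ℚ
  step k v = δ v (v ℕ.+ k)

  treeExits : ℕ → ℕ → ℚ
  treeExits zero    v = 0ℚ
  -- The r = `ratio j` translates of the previous tree are joined by only r - 1 edges; as r · g (j +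
  -- 1) = g j, this is the source of the coefficient g j - g (j + 1).
  treeExits (suc j) v = ∑ (ratio j) (λ k → treeExits j (v ℕ.+ k ℕ.* φ (suc j)))
                      + ∑ (ratio j ℕ.∸ 1) (λ k → step (φ (suc j)) (v ℕ.+ k ℕ.* φ (suc j)))

  0≤treeExits : ∀ j v → 0ℚ ≤ treeExits j v
  0≤treeExits zero    v = ≤-refl
  0≤treeExits (suc j) v = 0≤+0≤ (sumFin-nonneg {ratio j} (λ k → 0≤treeExits j _))
                                (sumFin-nonneg {ratio j ℕ.∸ 1} (λ k → 0≤δ _ _))

  path-bound : ∀ m k v → p v ≤ ∑ k (λ i → step m (v ℕ.+ i ℕ.* m)) + p (v ℕ.+ k ℕ.* m)
  path-bound m zero    v = ≤-reflexive (trans (cong p (sym (ℕₚ.+-identityʳ v))) (sym (+-identityˡ _)))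
  path-bound m (suc k) v = begin
    p v                                    ≤⟨ path-bound m k v ⟩
    ∑ k f + p u                            ≤⟨ +-monoʳ-≤ (∑ k f) (p≤δ+p u (u ℕ.+ m)) ⟩
    ∑ k f + (f k + p (u ℕ.+ m))            ≡⟨ +-assoc (∑ k f) (f k) _ ⟨
    (∑ k f + f k) + p (u ℕ.+ m)            ≡⟨ cong₂ _+_ (sym (∑-last k f)) (cong p (lemma v (k ℕ.* m) m)) ⟩
    ∑ (suc k) f + p (v ℕ.+ suc k ℕ.* m)    ∎
    where
    open ≤-Reasoning
    f : ℕ → ℚ
    f i = step m (v ℕ.+ i ℕ.* m)
    u = v ℕ.+ k ℕ.* m
    lemma : ∀ v x m → v ℕ.+ x ℕ.+ m ≡ v ℕ.+ (m ℕ.+ x)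
    lemma = solve-∀

  -- By `≅-gcd`, w lies in one of the translated subtrees, say the k-th. The path to its root and
  -- the tree path inside it pay for the drop of p; all other edges only add nonnegative terms. At
  -- level 0 the modulus is n, so v and w are the same vertex.
  treeExits-bound : ∀ j {v w} → v ≅ w [ g j ] → p v ≤ treeExits j v + p w
  treeExits-bound zero    v≅w = ≤-reflexive (trans (periodic-≅ p-periodic v≅w) (sym (+-identityˡ _)))
  treeExits-bound (suc j) {v} {w} v≅w with ≅-gcd (φ (suc j)) (g j) {{gSeq-nonZero n φ j}} v≅w
  ... | k , k<r , vk≅w = begin
    p v                                    ≤⟨ path-bound (φ (suc j)) k v ⟩
    ∑ k s + p (v ℕ.+ k ℕ.* φ (suc j))      ≤⟨ +-mono-≤ (∑-prefix {k} {ratio j ℕ.∸ 1} (λ i → 0≤δ (v ℕ.+ i ℕ.* φ (suc j)) (v ℕ.+ i ℕ.* φ (suc j) ℕ.+ φ (suc j))) (k≤r-1 k<r)) (treeExits-bound j vk≅w) ⟩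
    ∑ (ratio j ℕ.∸ 1) s + (e k + p w)      ≤⟨ +-monoʳ-≤ (∑ (ratio j ℕ.∸ 1) s) (+-monoˡ-≤ (p w) (∑-term {ratio j} (λ i → 0≤treeExits j _) k k<r)) ⟩
    ∑ (ratio j ℕ.∸ 1) s + (∑ (ratio j) e + p w)
      ≡⟨ solve 3 (λ a b c → a :+ (b :+ c) := (b :+ a) :+ c) refl (∑ (ratio j ℕ.∸ 1) s) (∑ (ratio j) e) (p w) ⟩
    treeExits (suc j) v + p w              ∎
    where
    open ≤-Reasoning
    s e : ℕ → ℚ
    s i = step (φ (suc j)) (v ℕ.+ i ℕ.* φ (suc j))
    e i = treeExits j (v ℕ.+ i ℕ.* φ (suc j))
    k≤r-1 : ∀ {k r} → k ℕ.< r → k ℕ.≤ r ℕ.∸ 1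
    k≤r-1 (ℕ.s≤s k≤r) = k≤r

  step-periodic : ∀ m → Periodic n (step m)
  step-periodic m v = trans (cong (δ (v ℕ.+ n)) (lemma v n m)) (δ-periodic v (v ℕ.+ m))
    where
    lemma : ∀ v n m → v ℕ.+ n ℕ.+ m ≡ v ℕ.+ m ℕ.+ n
    lemma = solve-∀

  treeExits-periodic : ∀ j → Periodic n (treeExits j)
  treeExits-periodic zero    v = refl
  treeExits-periodic (suc j) v = cong₂ _+_
    (∑-cong (ratio j) (λ k → periodic-shift (treeExits-periodic j) (k ℕ.* φ (suc j)) v))
    (∑-cong (ratio j ℕ.∸ 1) (λ k → periodic-shift (step-periodic (φ (suc j))) (k ℕ.* φ (suc j)) v))

  -- When the root runs through a coset mod d, so does the tail of each tree edge, because d divides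
  -- every stripe used. All edges of one stripe therefore contribute the same sum, and it remains to
  -- count them: (g (i - 1) - g i) / g j for stripe φ i. The factor `g j` clears this denominator.
  treeExits-sum : ∀ M d a → M ℕ.* d ≡ n → ∀ j → (∀ i → 1 ℕ.≤ i → i ℕ.≤ j → d ∣ φ i) →
    ℕtoℚ (g j) * ∑coset M d a (treeExits j) ≡
    sumTo j (λ i → diffℚ (g (i ℕ.∸ 1)) (g i) * ∑coset M d a (step (φ i)))
  treeExits-sum M d a Md≡n zero    _ = trans (cong (ℕtoℚ n *_) (sumFin-zero M)) (*-zeroʳ (ℕtoℚ n))
  treeExits-sum M d a Md≡n (suc j) d∣φ = begin
    γ′ * σ (treeExits (suc j))
      ≡⟨ cong (γ′ *_) (sumFin-+ {M} _ _) ⟩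
    γ′ * (∑ M (λ t → ∑ r (λ k → treeExits j (a ℕ.+ t ℕ.* d ℕ.+ k ℕ.* m))) +
          ∑ M (λ t → ∑ (r ℕ.∸ 1) (λ k → step m (a ℕ.+ t ℕ.* d ℕ.+ k ℕ.* m))))
      ≡⟨ cong (γ′ *_) (cong₂ _+_ (translates r (treeExits-periodic j)) (translates (r ℕ.∸ 1) (step-periodic m))) ⟩
    γ′ * (ℕtoℚ r * X + ℕtoℚ (r ℕ.∸ 1) * Y)
      ≡⟨ solve 5 (λ γ′ r r′ X Y → γ′ :* (r :* X :+ r′ :* Y) := (r :* γ′) :* X :+ (r′ :* γ′) :* Y) refl γ′ (ℕtoℚ r) (ℕtoℚ (r ℕ.∸ 1)) X Y ⟩
    (ℕtoℚ r * γ′) * X + (ℕtoℚ (r ℕ.∸ 1) * γ′) * Y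
      ≡⟨ cong₂ (λ u v → u * X + v * Y) rγ′≡γ r-1γ′ ⟩
    ℕtoℚ (g j) * X + diffℚ (g j) (g (suc j)) * Y
      ≡⟨ cong (_+ diffℚ (g j) (g (suc j)) * Y)
              (treeExits-sum M d a Md≡n j (λ i 1≤i i≤j → d∣φ i 1≤i (ℕₚ.m≤n⇒m≤1+n i≤j))) ⟩
    sumTo (suc j) (λ i → diffℚ (g (i ℕ.∸ 1)) (g i) * σ (step (φ i))) ∎
    where
    open ≡-Reasoning
    m = φ (suc j)
    r = ratio j
    γ′ = ℕtoℚ (g (suc j))
    σ = ∑coset M d a
    X = σ (treeExits j)
    Y = σ (step m)
    gj≡r*g : g j ≡ r ℕ.* g (suc j)
    gj≡r*g = _∣_.equality (gcd[m,n]∣n (φ (suc j)) (g j))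
    r>0 : ∀ r → g j ≡ r ℕ.* g (suc j) → r ≡ suc (r ℕ.∸ 1)
    r>0 zero    e = contradiction e (ℕ.≢-nonZero⁻¹ (g j) {{gSeq-nonZero n φ j}})
    r>0 (suc r) e = refl
    rγ′≡γ : ℕtoℚ r * γ′ ≡ ℕtoℚ (g j)
    rγ′≡γ = trans (sym (ℕtoℚ-homo-* r (g (suc j)))) (cong ℕtoℚ (sym gj≡r*g))
    r-1γ′ : ℕtoℚ (r ℕ.∸ 1) * γ′ ≡ diffℚ (g j) (g (suc j))
    r-1γ′ = begin
      ℕtoℚ (r ℕ.∸ 1) * γ′                ≡⟨ solve 2 (λ x y → x :* y := (con 1ℚ :+ x) :* y :- y) refl (ℕtoℚ (r ℕ.∸ 1)) γ′ ⟩
      (1ℚ + ℕtoℚ (r ℕ.∸ 1)) * γ′ - γ′    ≡⟨ cong (λ z → z * γ′ - γ′) (trans (sym (ℕtoℚ-suc (r ℕ.∸ 1))) (cong ℕtoℚ (sym (r>0 r gj≡r*g)))) ⟩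
      ℕtoℚ r * γ′ - γ′                   ≡⟨ cong (_- γ′) rγ′≡γ ⟩
      ℕtoℚ (g j) - γ′                    ≡⟨ diffℚ≡ (g j) (g (suc j)) ⟨
      diffℚ (g j) (g (suc j))            ∎
    translates : ∀ r {h} → Periodic n h → ∑ M (λ t → ∑ r (λ k → h (a ℕ.+ t ℕ.* d ℕ.+ k ℕ.* m))) ≡ ℕtoℚ r * σ h
    translates r {h} per = trans (sumFin-swap {M} {r} (λ t k → h (a ℕ.+ toℕ t ℕ.* d ℕ.+ toℕ k ℕ.* m)))
      (trans (∑-cong r (λ k → ∑coset-translate M d a (subst (λ N → Periodic N h) (sym Md≡n) per) (d∣km k)))
             (sumFin-const r (σ h)))
      where
      d∣km : ∀ k → d ∣ k ℕ.* m
      d∣km k = ∣-trans (d∣φ (suc j) (ℕ.s≤s ℕ.z≤n) ℕₚ.≤-refl) (divides k refl)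

indicator : Bool → ℚ
indicator b = if b then 1ℚ else 0ℚ

0≤1 : 0ℚ ≤ 1ℚ
0≤1 = 0≤ℕtoℚ 1

0≤indicator : ∀ b → 0ℚ ≤ indicator b
0≤indicator true  = 0≤1
0≤indicator false = ≤-refl

module Boundary (n : ℕ) .{{_ : NonZero n}} (S : Fin n → Bool) where

  member : ℕ → Bool
  member v = S (v mod n)

  χ : ℕ → ℚ
  χ v = indicator (member v)

  leaves : ℕ → ℕ → ℚ
  leaves u v = indicator (member u ∧ not (member v))

  boundary : ℕ → ℚ
  boundary k = ∑ n (λ v → leaves v (v ℕ.+ k))

  member-periodic : ∀ v → member (v ℕ.+ n) ≡ member v
  member-periodic v = cong S (fromℕ<-cong _ _ ([m+n]%n≡m%n v n) (m%n<n (v ℕ.+ n) n) (m%n<n v n))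

  member-toℕ : ∀ x → member (toℕ x) ≡ S x
  member-toℕ x = cong S (trans (fromℕ<-cong _ _ (m<n⇒m%n≡m (toℕ<n x)) (m%n<n (toℕ x) n) (toℕ<n x)) (fromℕ<-toℕ x (toℕ<n x)))

  χ-periodic : Periodic n χ
  χ-periodic v = cong indicator (member-periodic v)

  leaves-periodic : ∀ u v → leaves (u ℕ.+ n) (v ℕ.+ n) ≡ leaves u v
  leaves-periodic u v = cong₂ (λ a b → indicator (a ∧ not b)) (member-periodic u) (member-periodic v)

  leaves-step-periodic : ∀ k → Periodic n (λ v → leaves v (v ℕ.+ k))
  leaves-step-periodic k v = trans (cong (leaves (v ℕ.+ n)) (lemma v n k)) (leaves-periodic v (v ℕ.+ k))
    where
    lemma : ∀ v n m → v ℕ.+ n ℕ.+ m ≡ v ℕ.+ m ℕ.+ n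
    lemma = solve-∀

  0≤leaves : ∀ u v → 0ℚ ≤ leaves u v
  0≤leaves u v = 0≤indicator _

  χ≤leaves+χ : ∀ u v → χ u ≤ leaves u v + χ v
  χ≤leaves+χ u v with member u | member v
  ... | true  | true  = ≤-refl
  ... | true  | false = ≤-refl
  ... | false | true  = 0≤1
  ... | false | false = ≤-refl

  -χ≤leaves-χ : ∀ u v → - χ u ≤ leaves v u + - χ v
  -χ≤leaves-χ u v = subst₂ _≤_
    (solve 2 (λ x y → y :+ (:- x :- y) := :- x) refl (χ u) (χ v))
    (solve 3 (λ l x y → (l :+ x) :+ (:- x :- y) := l :+ :- y) refl (leaves v u) (χ u) (χ v))
    (+-monoˡ-≤ (- χ u - χ v) (χ≤leaves+χ v u))

  leaves-antisym : ∀ u v → leaves v u ≡ leaves u v + (χ v - χ u)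
  leaves-antisym u v with member u | member v
  ... | true  | true  = refl
  ... | true  | false = refl
  ... | false | true  = refl
  ... | false | false = refl

  -- The two sides differ by the sum of χ (v + k) - χ v, which vanishes as the coset is invariant under translation by k.
  coset-in≡out : ∀ M d a → M ℕ.* d ≡ n → ∀ {k} → d ∣ k →
    ∑coset M d a (λ v → leaves (v ℕ.+ k) v) ≡ ∑coset M d a (λ v → leaves v (v ℕ.+ k))
  coset-in≡out M d a Md≡n {k} d∣k = begin
    σ (λ v → leaves (v ℕ.+ k) v)
      ≡⟨ sumFin-cong {M} (λ t → leaves-antisym (v (toℕ t)) (v (toℕ t) ℕ.+ k)) ⟩
    σ (λ v → leaves v (v ℕ.+ k) + (χ (v ℕ.+ k) - χ v))
      ≡⟨ sumFin-+ {M} _ _ ⟩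
    L + σ (λ v → χ (v ℕ.+ k) - χ v)
      ≡⟨ cong (_+_ L) (sumFin-+ {M} _ _) ⟩
    L + (σ (λ v → χ (v ℕ.+ k)) + σ (λ v → - χ v))
      ≡⟨ cong (λ z → L + (z + σ (λ v → - χ v))) (∑coset-translate M d a (subst (λ N → Periodic N χ) (sym Md≡n) χ-periodic) d∣k) ⟩
    L + (σ χ + σ (λ v → - χ v))
      ≡⟨ cong (_+_ L) (trans (sym (sumFin-+ {M} _ _)) (trans (sumFin-cong {M} (λ t → +-inverseʳ (χ (v (toℕ t))))) (sumFin-zero M))) ⟩
    L + 0ℚ
      ≡⟨ +-identityʳ L ⟩
    L ∎
    where
    open ≡-Reasoning
    v : ℕ → ℕ
    v t = a ℕ.+ t ℕ.* d
    σ = ∑coset M d a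
    L = σ (λ v → leaves v (v ℕ.+ k))

  -- The case d = 1, in which a single coset is all of ℤ/n.
  in≡out : ∀ k → ∑ n (λ v → leaves (v ℕ.+ k) v) ≡ boundary k
  in≡out k = trans (∑-cong n (λ v → cong (λ z → leaves (z ℕ.+ k) z) (sym (ℕₚ.*-identityʳ v))))
    (trans (coset-in≡out n 1 0 (ℕₚ.*-identityʳ n) {k} (divides k (sym (ℕₚ.*-identityʳ k))))
      (∑-cong n (λ v → cong (λ z → leaves z (z ℕ.+ k)) (ℕₚ.*-identityʳ v))))

  module _ (φ : ℕ → ℕ) (j : ℕ) (g≢1 : gSeq n φ j ≢ 1) (gcd≡1 : gSeq n φ (suc j) ≡ 1) where

    private
      g = gSeq n φ j
      m = φ (suc j)
      instance
        g-nonZero : NonZero g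
        g-nonZero = gSeq-nonZero n φ j

    -- The walk stops at the first step that leaves S. If none of the earlier steps does, the last
    -- one ends at a vertex that need not be y but is congruent to y mod g; y then shows that this
    -- coset is not contained in S.
    exit-along : ∀ k {x y} → member x ≡ true → member y ≡ false → x ℕ.+ suc k ℕ.* m ≅ y [ g ] →
      ∃₂ λ a u → member a ≡ true × member u ≡ false × a ℕ.+ m ≅ u [ g ]
    exit-along zero {x} {y} x∈ y∉ e = x , y , x∈ , y∉ , subst (λ z → x ℕ.+ z ≅ y [ g ]) (ℕₚ.*-identityˡ m) e
    exit-along (suc k) {x} {y} x∈ y∉ e with member (x ℕ.+ m) in eq
    ... | true  = exit-along k eq y∉ (subst (_≅ y [ g ]) (sym (ℕₚ.+-assoc x m (suc k ℕ.* m))) e)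
    ... | false = x , x ℕ.+ m , x∈ , eq , 0 , 0 , refl

    exit : ∃ (λ v → S v ≡ true) → ∃ (λ v → S v ≡ false) →
      ∃₂ λ a u → member a ≡ true × member u ≡ false × a ℕ.+ m ≅ u [ g ]
    -- Modulo gcd m g = 1 all vertices are congruent, by x + y · 1 = y + x · 1.
    exit (x , x∈) (y , y∉) with ≅-gcd m g {toℕ x} {toℕ y} (subst (toℕ x ≅ toℕ y [_]) (sym gcd≡1)
                                 (toℕ y , toℕ x , trans (cong (toℕ x ℕ.+_) (ℕₚ.*-identityʳ (toℕ y)))
                                   (trans (ℕₚ.+-comm (toℕ x) (toℕ y)) (cong (toℕ y ℕ.+_) (sym (ℕₚ.*-identityʳ (toℕ x)))))))
    -- If x and y share a coset, k may be 0, but `exit-along` makes at least one step. Adding g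
    -- steps changes the endpoint by m g, hence not its class mod g, and k + g is the successor of k
    -- + (g - 1).
    ... | k , _ , a , b , e = exit-along (k ℕ.+ (g ℕ.∸ 1)) (trans (member-toℕ x) x∈) (trans (member-toℕ y) y∉)
              (a , b ℕ.+ m , (begin
        toℕ x ℕ.+ suc (k ℕ.+ (g ℕ.∸ 1)) ℕ.* m ℕ.+ a ℕ.* g
          ≡⟨ cong (λ z → toℕ x ℕ.+ z ℕ.* m ℕ.+ a ℕ.* g) (trans (sym (ℕₚ.+-suc k (g ℕ.∸ 1))) (cong (k ℕ.+_) (ℕₚ.suc-pred g))) ⟩
        toℕ x ℕ.+ (k ℕ.+ g) ℕ.* m ℕ.+ a ℕ.* g
          ≡⟨ lemma (toℕ x) k g m a ⟩
        toℕ x ℕ.+ k ℕ.* m ℕ.+ a ℕ.* g ℕ.+ m ℕ.* g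
          ≡⟨ cong (ℕ._+ m ℕ.* g) e ⟩
        toℕ y ℕ.+ b ℕ.* g ℕ.+ m ℕ.* g
          ≡⟨ lemma′ (toℕ y) b g m ⟩
        toℕ y ℕ.+ (b ℕ.+ m) ℕ.* g ∎))
      where
      open ≡-Reasoning
      lemma : ∀ x k g m a → x ℕ.+ (k ℕ.+ g) ℕ.* m ℕ.+ a ℕ.* g ≡ x ℕ.+ k ℕ.* m ℕ.+ a ℕ.* g ℕ.+ m ℕ.* g
      lemma = solve-∀
      lemma′ : ∀ y b g m → y ℕ.+ b ℕ.* g ℕ.+ m ℕ.* g ≡ y ℕ.+ (b ℕ.+ m) ℕ.* g
      lemma′ = solve-∀

    g∤m : ¬ g ∣ m
    g∤m g∣m = g≢1 (∣1⇒≡1 (subst (g ∣_) gcd≡1 (gcd-greatest g∣m ∣-refl)))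

    private
      -- Reversing all edges turns the out-arborescence into an in-arborescence: a step from u to v
      -- is charged when the edge from v to u leaves S, and the potential becomes -χ.
      module In  = Arborescence n φ (λ v → - χ v) (λ u v → leaves v u) (λ v → cong -_ (χ-periodic v))
                     (λ u v → leaves-periodic v u) (λ u v → 0≤leaves v u) -χ≤leaves-χ
      module Out = Arborescence n φ χ leaves χ-periodic leaves-periodic 0≤leaves χ≤leaves+χ

    -- Each of the n / g translates, by multiples of g, of the walk "in-tree of a coset meeting S, one stripe-m edge,
    -- out-tree of the next coset, which is not contained in S" leaves S.
    boundary-bound : ∃ (λ v → S v ≡ true) → ∃ (λ v → S v ≡ false) →
      ℕtoℚ n ≤ sumTo j (λ i → diffℚ (gSeq n φ (i ℕ.∸ 1)) (gSeq n φ i) * boundary (φ i)) + ℕtoℚ g * boundary m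
    boundary-bound ∃∈ ∃∉ with exit ∃∈ ∃∉ | gSeq-∣ n φ {0} {j} ℕ.z≤n
    ... | a , u , a∈ , u∉ , a+m≅u | divides M n≡Mg = begin
      ℕtoℚ n
        ≡⟨ trans (cong ℕtoℚ n≡Mg) (trans (ℕtoℚ-homo-* M g) (trans (*-comm (ℕtoℚ M) γ) (cong (_*_ γ) (sym (trans (sumFin-const M 1ℚ) (*-identityʳ (ℕtoℚ M))))))) ⟩
      γ * ∑ M (λ _ → 1ℚ)
        ≤⟨ *-monoˡ-≤ (0≤ℕtoℚ g) (sumFin-mono {M} (λ t → walk-exits (toℕ t))) ⟩
      γ * ∑ M (λ t → In.treeExits j (v t) + (leaves (v t) (v t ℕ.+ m) + Out.treeExits j (v t ℕ.+ m)))
        ≡⟨ cong (_*_ γ) (trans (sumFin-+ {M} _ _) (cong (_+_ I) (trans (sumFin-+ {M} _ _) (cong (_+_ L) (∑-cong M (λ t → cong (Out.treeExits j) (comm a (t ℕ.* g) m))))))) ⟩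
      γ * (I + (L + O))
        ≡⟨ solve 4 (λ γ I L O → γ :* (I :+ (L :+ O)) := (γ :* I :+ γ :* O) :+ γ :* L) refl γ I L O ⟩
      (γ * I + γ * O) + γ * L
        ≡⟨ cong (_+ γ * L) (cong₂ _+_ (In.treeExits-sum M g a (sym n≡Mg) j g∣φ) (Out.treeExits-sum M g (a ℕ.+ m) (sym n≡Mg) j g∣φ)) ⟩
      (sumTo j (λ i → Δ i * ∑coset M g a (λ v → leaves (v ℕ.+ φ i) v)) +
       sumTo j (λ i → Δ i * ∑coset M g (a ℕ.+ m) (λ v → leaves v (v ℕ.+ φ i)))) + γ * L
        ≡⟨ cong (_+ γ * L) (sumTo-+ j _ _) ⟨
      sumTo j (λ i → Δ i * ∑coset M g a (λ v → leaves (v ℕ.+ φ i) v)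
                   + Δ i * ∑coset M g (a ℕ.+ m) (λ v → leaves v (v ℕ.+ φ i))) + γ * L
        -- The edges of the in-trees and of the out-trees lie in two different cosets, so together
        -- they count each exit along a stripe φ i with i ≤ j at most once. The connecting edges all
        -- start in the coset of a.
        ≤⟨ +-mono-≤ (sumTo-mono j stripe) (*-monoˡ-≤ (0≤ℕtoℚ g)
             (subst (λ N → L ≤ ∑ N (step m)) (sym n≡Mg) (coset-≤ M g a (per m) (λ v → 0≤leaves v (v ℕ.+ m))))) ⟩
      sumTo j (λ i → Δ i * boundary (φ i)) + γ * boundary m ∎
      where
      open ≤-Reasoning
      γ = ℕtoℚ g
      Δ : ℕ → ℚ
      Δ i = diffℚ (gSeq n φ (i ℕ.∸ 1)) (gSeq n φ i)
      v : ℕ → ℕ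
      v t = a ℕ.+ t ℕ.* g
      step : ℕ → ℕ → ℚ
      step k v = leaves v (v ℕ.+ k)
      per : ∀ k → Periodic (M ℕ.* g) (step k)
      per k = subst (λ N → Periodic N (step k)) n≡Mg (leaves-step-periodic k)
      g∣φ : ∀ i → 1 ℕ.≤ i → i ℕ.≤ j → g ∣ φ i
      g∣φ i = gSeq-∣φ n φ
      I = ∑coset M g a (In.treeExits j)
      L = ∑coset M g a (step m)
      O = ∑coset M g (a ℕ.+ m) (Out.treeExits j)
      comm : ∀ a x m → a ℕ.+ x ℕ.+ m ≡ a ℕ.+ m ℕ.+ x
      comm = solve-∀
      v≅a : ∀ t → v t ≅ a [ g ]
      v≅a t = 0 , t , ℕₚ.+-identityʳ (v t)
      v+m≅u : ∀ t → v t ℕ.+ m ≅ u [ g ]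
      v+m≅u t = let b , b′ , e = a+m≅u in b , b′ ℕ.+ t , trans (lemma a t g m b) (trans (cong (ℕ._+ t ℕ.* g) e) (lemma′ u b′ g t))
        where
        lemma : ∀ a t g m b → a ℕ.+ t ℕ.* g ℕ.+ m ℕ.+ b ℕ.* g ≡ a ℕ.+ m ℕ.+ b ℕ.* g ℕ.+ t ℕ.* g
        lemma = solve-∀
        lemma′ : ∀ u b g t → u ℕ.+ b ℕ.* g ℕ.+ t ℕ.* g ≡ u ℕ.+ (b ℕ.+ t) ℕ.* g
        lemma′ = solve-∀
      walk-exits : ∀ t → 1ℚ ≤ In.treeExits j (v t) + (leaves (v t) (v t ℕ.+ m) + Out.treeExits j (v t ℕ.+ m))
      -- The bounds for in-tree, connecting edge and out-tree are added. After adding χ a - χ (v t +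
      -- m) the intermediate values of χ cancel, leaving χ a = 1 on the left and χ u = 0 on the
      -- right.
      walk-exits t = subst₂ _≤_
        (trans (solve 3 (λ x y A → (:- x :+ (x :+ y)) :+ (A :- y) := A) refl (χ (v t)) (χ (v t ℕ.+ m)) (χ a)) (cong indicator a∈))
        (trans (solve 6 (λ i A l y o U → ((i :+ :- A) :+ ((l :+ y) :+ (o :+ U))) :+ (A :- y) := (i :+ (l :+ o)) :+ U) refl
                 (In.treeExits j (v t)) (χ a) (leaves (v t) (v t ℕ.+ m)) (χ (v t ℕ.+ m)) (Out.treeExits j (v t ℕ.+ m)) (χ u))
          (trans (cong (λ b → (In.treeExits j (v t) + (leaves (v t) (v t ℕ.+ m) + Out.treeExits j (v t ℕ.+ m))) + indicator b) u∉) (+-identityʳ _)))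
        (+-monoˡ-≤ (χ a - χ (v t ℕ.+ m))
          (+-mono-≤ (In.treeExits-bound j (v≅a t))
            (+-mono-≤ (χ≤leaves+χ (v t) (v t ℕ.+ m)) (Out.treeExits-bound j (v+m≅u t)))))
      stripe : ∀ i → 1 ℕ.≤ i → i ℕ.≤ j →
        Δ i * ∑coset M g a (λ v → leaves (v ℕ.+ φ i) v) + Δ i * ∑coset M g (a ℕ.+ m) (step (φ i)) ≤ Δ i * boundary (φ i)
      stripe i@(suc i-1) 1≤i i≤j = begin
        Δ i * ∑coset M g a (λ v → leaves (v ℕ.+ φ i) v) + Δ i * ∑coset M g (a ℕ.+ m) (step (φ i))
          ≡⟨ cong (λ z → Δ i * z + Δ i * ∑coset M g (a ℕ.+ m) (step (φ i))) (coset-in≡out M g a (sym n≡Mg) (g∣φ i 1≤i i≤j)) ⟩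
        Δ i * ∑coset M g a (step (φ i)) + Δ i * ∑coset M g (a ℕ.+ m) (step (φ i))
          ≡⟨ *-distribˡ-+ (Δ i) _ _ ⟨
        Δ i * (∑coset M g a (step (φ i)) + ∑coset M g (a ℕ.+ m) (step (φ i)))
          ≤⟨ *-monoˡ-≤ (0≤diffℚ (gSeq-step-≤ n φ i-1)) (two-cosets-≤ M g a (per (φ i)) (λ v → 0≤leaves v (v ℕ.+ φ i)) g∤m) ⟩
        Δ i * ∑ (M ℕ.* g) (step (φ i))
          ≡⟨ cong (λ N → Δ i * ∑ N (step (φ i))) n≡Mg ⟨
        Δ i * boundary (φ i) ∎

-- Summation over stripes

edgeLen≡ : ∀ n (u v : Fin n) → edgeLen n u v ≡ ∣ toℕ u - toℕ v ∣ ⊓ (n ∸ ∣ toℕ u - toℕ v ∣)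
edgeLen≡ n u v = cong (λ z → z ⊓ (n ∸ z)) (dist (toℕ u) (toℕ v))
  where
  dist : ∀ a b → (if a ≤ᵇ b then b ∸ a else a ∸ b) ≡ ∣ a - b ∣
  dist a b with a ≤ᵇ b | ℕₚ.≤ᵇ-reflects-≤ a b
  ... | true  | ofʸ a≤b = sym (ℕₚ.m≤n⇒∣m-n∣≡n∸m a≤b)
  ... | false | ofⁿ a≰b = sym (ℕₚ.m≤n⇒∣n-m∣≡n∸m (ℕₚ.≰⇒≥ a≰b))

edgeLen-sym : ∀ n (u v : Fin n) → edgeLen n u v ≡ edgeLen n v u
edgeLen-sym n u v = trans (edgeLen≡ n u v)
  (trans (cong (λ z → z ⊓ (n ∸ z)) (ℕₚ.∣-∣-comm (toℕ u) (toℕ v))) (sym (edgeLen≡ n v u)))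

edgeLen-diag : ∀ n (u : Fin n) → edgeLen n u u ≡ 0
edgeLen-diag n u = trans (edgeLen≡ n u u) (cong (λ z → z ⊓ (n ∸ z)) (ℕₚ.∣n-n∣≡0 (toℕ u)))

-- The offset s from a to v modulo n, with n - a in place of -a, is the distance D or n - D
-- according to the order of a and v, and the minimum is symmetric in these two.
edgeLen-offset : ∀ n .{{_ : NonZero n}} a v → a ℕ.< n → v ℕ.< n →
  let s = (v ℕ.+ (n ∸ a)) DivMod.% n in s ⊓ (n ∸ s) ≡ ∣ a - v ∣ ⊓ (n ∸ ∣ a - v ∣)
edgeLen-offset n a v a<n v<n with ℕₚ.≤-<-connex a v
... | inj₁ a≤v = cong (λ z → z ⊓ (n ∸ z)) (begin
  (v ℕ.+ (n ∸ a)) DivMod.% n     ≡⟨ cong (DivMod._% n) (sym (ℕₚ.+-∸-assoc v (ℕₚ.<⇒≤ a<n))) ⟩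
  (v ℕ.+ n ∸ a) DivMod.% n       ≡⟨ cong (DivMod._% n) (trans (cong (_∸ a) (ℕₚ.+-comm v n)) (trans (ℕₚ.+-∸-assoc n a≤v) (ℕₚ.+-comm n (v ∸ a)))) ⟩
  (v ∸ a ℕ.+ n) DivMod.% n       ≡⟨ [m+n]%n≡m%n (v ∸ a) n ⟩
  (v ∸ a) DivMod.% n             ≡⟨ m<n⇒m%n≡m (ℕₚ.≤-<-trans (ℕₚ.m∸n≤m v a) v<n) ⟩
  v ∸ a                          ≡⟨ ℕₚ.m≤n⇒∣m-n∣≡n∸m a≤v ⟨
  ∣ a - v ∣                      ∎)
  where open ≡-Reasoning
... | inj₂ v<a = begin
  s ⊓ (n ∸ s)                    ≡⟨ cong (λ z → z ⊓ (n ∸ z)) s≡ ⟩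
  (n ∸ D) ⊓ (n ∸ (n ∸ D))        ≡⟨ cong ((n ∸ D) ⊓_) (ℕₚ.m∸[m∸n]≡n D≤n) ⟩
  (n ∸ D) ⊓ D                    ≡⟨ ℕₚ.⊓-comm (n ∸ D) D ⟩
  D ⊓ (n ∸ D)                    ≡⟨ cong (λ z → z ⊓ (n ∸ z)) (ℕₚ.m≤n⇒∣n-m∣≡n∸m (ℕₚ.<⇒≤ v<a)) ⟨
  ∣ a - v ∣ ⊓ (n ∸ ∣ a - v ∣)    ∎
  where
  open ≡-Reasoning
  s = (v ℕ.+ (n ∸ a)) DivMod.% n
  D = a ∸ v
  D≤n : D ℕ.≤ n
  D≤n = ℕₚ.≤-trans (ℕₚ.m∸n≤m a v) (ℕₚ.<⇒≤ a<n)
  v+n-a : v ℕ.+ (n ∸ a) ≡ n ∸ D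
  v+n-a = sym (trans (cong (_∸ D) (sym (ℕₚ.m∸n+n≡m (ℕₚ.<⇒≤ a<n))))
    (trans (ℕₚ.+-∸-assoc (n ∸ a) (ℕₚ.m∸n≤m a v)) (trans (cong ((n ∸ a) ℕ.+_) (ℕₚ.m∸[m∸n]≡n (ℕₚ.<⇒≤ v<a))) (ℕₚ.+-comm (n ∸ a) v))))
  s≡ : s ≡ n ∸ D
  s≡ = trans (cong (DivMod._% n) v+n-a) (m<n⇒m%n≡m (ℕₚ.∸-monoʳ-< (ℕₚ.m<n⇒0<n∸m v<a) D≤n))

-- The offsets k and n - k from a vertex reach the same vertex if k = n/2; κ compensates the double count.
κ : ℕ → ℕ → ℚ
κ n k = if k ℕ.* 2 ≡ᵇ n then ½ else 1ℚ

κ-1 : ∀ {n k} → k ℕ.* 2 ≢ n → κ n k ≡ 1ℚ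
κ-1 {n} {k} h with k ℕ.* 2 ≡ᵇ n | proof (k ℕ.* 2 ℕₚ.≟ n)
... | true  | ofʸ e = contradiction e h
... | false | _     = refl

κ-½ : ∀ {n k} → k ℕ.* 2 ≡ n → κ n k ≡ ½
κ-½ {n} {k} h with k ℕ.* 2 ≡ᵇ n | proof (k ℕ.* 2 ℕₚ.≟ n)
... | true  | _     = refl
... | false | ofⁿ e = contradiction h e

-- With n = e + d + 1, the offsets above e are read backwards as n - k for 1 ≤ k ≤ d.
∑-reverse-tail : ∀ e d (H : ℕ → ℚ) → ∑ d (λ i → H (e ℕ.+ suc i)) ≡ ∑ d (λ i → H (suc (e ℕ.+ d) ∸ suc i))
∑-reverse-tail e d H = trans (sym (∑-reverse d (λ i → H (e ℕ.+ suc i)))) (∑-cong< d (λ i i<d → cong H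
  (trans (cong (e ℕ.+_) (sym (ℕₚ.+-∸-assoc 1 i<d))) (sym (ℕₚ.+-∸-assoc e (ℕₚ.<⇒≤ i<d))))))

fold-odd : ∀ n d (H : ℕ → ℚ) → n ≡ suc (d ℕ.+ d) → sumTo (n ∸ 1) H ≡ sumTo d (λ k → κ n k * (H k + H (n ∸ k)))
fold-odd n d H refl = begin
  sumTo (d ℕ.+ d) H
    ≡⟨ trans (sumTo≡∑ (d ℕ.+ d) H) (∑-append d d (H ∘ suc)) ⟩
  ∑ d (H ∘ suc) + ∑ d (λ i → H (suc (d ℕ.+ i)))
    ≡⟨ cong (∑ d (H ∘ suc) +_) (trans (∑-cong d (λ i → cong H (sym (ℕₚ.+-suc d i)))) (∑-reverse-tail d d H)) ⟩
  ∑ d (H ∘ suc) + ∑ d (λ i → H (n ∸ suc i))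
    ≡⟨ sumFin-+ {d} _ _ ⟨
  ∑ d (λ i → H (suc i) + H (n ∸ suc i))
    ≡⟨ sumTo≡∑ d (λ k → H k + H (n ∸ k)) ⟨
  sumTo d (λ k → H k + H (n ∸ k))
    ≡⟨ sumTo-cong d (λ k _ k≤d → trans (sym (*-identityˡ _)) (cong (_* (H k + H (n ∸ k))) (sym (κ-1 {n} {k} (k2≢n k≤d))))) ⟩
  sumTo d (λ k → κ n k * (H k + H (n ∸ k))) ∎
  where
  open ≡-Reasoning
  lemma : ∀ k → k ℕ.* 2 ≡ k ℕ.+ k
  lemma = solve-∀
  k2≢n : ∀ {k} → k ℕ.≤ d → k ℕ.* 2 ≢ suc (d ℕ.+ d)
  k2≢n {k} k≤d e = ℕₚ.<-irrefl e (ℕ.s≤s (subst (ℕ._≤ d ℕ.+ d) (sym (lemma k)) (ℕₚ.+-mono-≤ k≤d k≤d)))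

fold-even : ∀ n d (H : ℕ → ℚ) → n ≡ suc (suc d ℕ.+ d) → sumTo (n ∸ 1) H ≡ sumTo (suc d) (λ k → κ n k * (H k + H (n ∸ k)))
fold-even n d H refl = begin
  sumTo (suc d ℕ.+ d) H
    ≡⟨ trans (sumTo≡∑ (suc d ℕ.+ d) H) (∑-append (suc d) d (H ∘ suc)) ⟩
  ∑ (suc d) (H ∘ suc) + ∑ d (λ i → H (suc (suc d ℕ.+ i)))
    ≡⟨ cong₂ _+_ (∑-last d (H ∘ suc)) (trans (∑-cong d (λ i → cong H (sym (ℕₚ.+-suc (suc d) i)))) (∑-reverse-tail (suc d) d H)) ⟩
  (∑ d (H ∘ suc) + H (suc d)) + ∑ d (λ i → H (n ∸ suc i))
    ≡⟨ solve 3 (λ a h b → (a :+ h) :+ b := (a :+ b) :+ con ½ :* (h :+ h)) refl (∑ d (H ∘ suc)) (H (suc d)) (∑ d (λ i → H (n ∸ suc i))) ⟩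
  (∑ d (H ∘ suc) + ∑ d (λ i → H (n ∸ suc i))) + ½ * (H (suc d) + H (suc d))
    ≡⟨ cong₂ (λ x y → x + ½ * (H (suc d) + H y)) (sym (sumFin-+ {d} _ _)) (sym n∸d) ⟩
  ∑ d (λ i → H (suc i) + H (n ∸ suc i)) + ½ * (H (suc d) + H (n ∸ suc d))
    ≡⟨ cong₂ _+_ (sym (sumTo≡∑ d (λ k → H k + H (n ∸ k)))) (cong (_* (H (suc d) + H (n ∸ suc d))) (sym (κ-½ {n} {suc d} (lemma d)))) ⟩
  sumTo d (λ k → H k + H (n ∸ k)) + κ n (suc d) * (H (suc d) + H (n ∸ suc d))
    ≡⟨ cong (_+ κ n (suc d) * (H (suc d) + H (n ∸ suc d)))
         (sumTo-cong d (λ k _ k≤d → trans (sym (*-identityˡ _)) (cong (_* (H k + H (n ∸ k))) (sym (κ-1 {n} {k} (k2≢n k≤d)))))) ⟩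
  sumTo (suc d) (λ k → κ n k * (H k + H (n ∸ k))) ∎
  where
  open ≡-Reasoning
  lemma : ∀ d → suc d ℕ.* 2 ≡ suc (suc d ℕ.+ d)
  lemma = solve-∀
  n∸d : suc d ℕ.+ d ∸ d ≡ suc d
  n∸d = ℕₚ.m+n∸n≡m (suc d) d
  k2≢n : ∀ {k} → k ℕ.≤ d → k ℕ.* 2 ≢ suc (suc d ℕ.+ d)
  k2≢n {k} k≤d e = ℕₚ.<-irrefl (trans e (sym (lemma d))) (ℕₚ.*-monoˡ-< 2 (ℕ.s≤s k≤d))

fold-stripes : ∀ n .{{_ : NonZero n}} (H : ℕ → ℚ) → sumTo (n ∸ 1) H ≡ sumTo (n ℕ./ 2) (λ k → κ n k * (H k + H (n ∸ k)))
fold-stripes n H with n ℕ.% 2 | n ℕ./ 2 | m≡m%n+[m/n]*n n 2 | m%n<n n 2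
... | 0 | zero  | e | _ = contradiction e (ℕ.≢-nonZero⁻¹ n)
... | 0 | suc d | e | _ = fold-even n d H (trans e (lemma d))
  where
  lemma : ∀ d → suc d ℕ.* 2 ≡ suc (suc d ℕ.+ d)
  lemma = solve-∀
... | 1 | d     | e | _ = fold-odd n d H (trans e (lemma d))
  where
  lemma : ∀ d → 1 ℕ.+ d ℕ.* 2 ≡ suc (d ℕ.+ d)
  lemma = solve-∀
... | suc (suc _) | _ | _ | ℕ.s≤s (ℕ.s≤s ())

half-≤ : ∀ {n k} → k ℕ.≤ n ℕ./ 2 → k ℕ.≤ n ∸ k
half-≤ {n} {k} k≤d = ℕₚ.m+n≤o⇒m≤o∸n k (ℕₚ.≤-trans (ℕₚ.≤-reflexive (lemma k)) (ℕₚ.≤-trans (ℕₚ.*-monoˡ-≤ 2 k≤d) (DivMod.m/n*n≤m n 2)))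
  where
  lemma : ∀ k → k ℕ.+ k ≡ k ℕ.* 2
  lemma = solve-∀

-- The vertices v are parametrised by their offset from u. Offset 0 contributes nothing as X 0 = 0,
-- and the offsets k and n - k, both of length k, are folded together. `G` reduces the offset mod n
-- in order to be periodic, so that the rotation is an instance of `∑-shift`; on 0, ..., n - 1 it
-- agrees with `H`.
row-sum : ∀ n .{{_ : NonZero n}} (X h : ℕ → ℚ) → X 0 ≡ 0ℚ → Periodic n h → ∀ (u : Fin n) →
  sumFin n (λ v → X (edgeLen n u v) * h (toℕ v)) ≡
  sumTo (n ℕ./ 2) (λ k → κ n k * X k * (h (toℕ u ℕ.+ k) + h (toℕ u ℕ.+ (n ∸ k))))
row-sum n@(suc n-1) X h X0≡0 per u = begin
  sumFin n (λ v → X (edgeLen n u v) * h (toℕ v))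
    ≡⟨ sumFin-cong (λ v → cong (λ z → X z * h (toℕ v)) (edgeLen≡ n u v)) ⟩
  ∑ n (λ v → X (∣ a - v ∣ ⊓ (n ∸ ∣ a - v ∣)) * h v)
    ≡⟨ ∑-cong< n (λ v v<n → cong₂ (λ y z → X y * z) (sym (edgeLen-offset n a v (toℕ<n u) v<n)) (sym (h-offset v))) ⟩
  ∑ n (λ v → G (v ℕ.+ (n ∸ a)))
    ≡⟨ ∑-shift {n} {G} G-periodic (n ∸ a) ⟩
  ∑ n G
    ≡⟨ ∑-cong< n {G} {H} (λ s s<n → cong (λ z → X (z ⊓ (n ∸ z)) * h (a ℕ.+ s)) (m<n⇒m%n≡m s<n)) ⟩
  ∑ n H
    ≡⟨ trans (cong (_+ ∑ n-1 (H ∘ suc)) (trans (cong (_* h (a ℕ.+ 0)) X0≡0) (*-zeroˡ (h (a ℕ.+ 0))))) (+-identityˡ _) ⟩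
  ∑ n-1 (H ∘ suc)
    ≡⟨ sumTo≡∑ n-1 H ⟨
  sumTo n-1 H
    ≡⟨ fold-stripes n H ⟩
  sumTo (n ℕ./ 2) (λ k → κ n k * (H k + H (n ∸ k)))
    ≡⟨ sumTo-cong (n ℕ./ 2) (λ k _ k≤d → trans (cong (κ n k *_) (cong₂ _+_
         (cong (λ z → X z * h (a ℕ.+ k)) (ℕₚ.m≤n⇒m⊓n≡m (half-≤ {n} k≤d)))
         (cong (λ z → X z * h (a ℕ.+ (n ∸ k))) (trans (cong ((n ∸ k) ⊓_) (ℕₚ.m∸[m∸n]≡n (k≤n k≤d))) (ℕₚ.m≥n⇒m⊓n≡n (half-≤ {n} k≤d))))))
         (solve 4 (λ κ x a b → κ :* (x :* a :+ x :* b) := κ :* x :* (a :+ b)) refl (κ n k) (X k) (h (a ℕ.+ k)) (h (a ℕ.+ (n ∸ k))))) ⟩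
  sumTo (n ℕ./ 2) (λ k → κ n k * X k * (h (a ℕ.+ k) + h (a ℕ.+ (n ∸ k)))) ∎
  where
  open ≡-Reasoning
  a = toℕ u
  G H : ℕ → ℚ
  G s = X (s DivMod.% n ⊓ (n ∸ s DivMod.% n)) * h (a ℕ.+ s)
  H s = X (s ⊓ (n ∸ s)) * h (a ℕ.+ s)
  G-periodic : Periodic n G
  G-periodic s = cong₂ (λ y z → X (y ⊓ (n ∸ y)) * z) ([m+n]%n≡m%n s n) (trans (cong h (sym (ℕₚ.+-assoc a s n))) (per (a ℕ.+ s)))
  h-offset : ∀ v → h (a ℕ.+ (v ℕ.+ (n ∸ a))) ≡ h v
  h-offset v = trans (cong h (trans (lemma a v (n ∸ a)) (cong (v ℕ.+_) (ℕₚ.m+[n∸m]≡n (ℕₚ.<⇒≤ (toℕ<n u)))))) (per v)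
    where
    lemma : ∀ a v x → a ℕ.+ (v ℕ.+ x) ≡ v ℕ.+ (a ℕ.+ x)
    lemma = solve-∀
  k≤n : ∀ {k} → k ℕ.≤ n ℕ./ 2 → k ℕ.≤ n
  k≤n k≤d = ℕₚ.≤-trans k≤d (DivMod.m/n≤m n 2)

-- A sum over edges, each taken once; `cost` is an instance by definition.
upperSum : ∀ n → (Fin n → Fin n → ℚ) → ℚ
upperSum n F = sumFin n (λ u → sumFin n (λ v → if toℕ u <ᵇ toℕ v then F u v else 0ℚ))

symmetric-sum : ∀ n (F : Fin n → Fin n → ℚ) → (∀ u v → F u v ≡ F v u) → (∀ u → F u u ≡ 0ℚ) →
  sumFin n (λ u → sumFin n (F u)) ≡ 2ℚ * upperSum n F
symmetric-sum n F F-sym F-diag = begin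
  sumFin n (λ u → sumFin n (F u))
    ≡⟨ sumFin-cong (λ u → trans (sumFin-cong (split u)) (sumFin-+ (U u) (λ v → U v u))) ⟩
  sumFin n (λ u → sumFin n (U u) + sumFin n (λ v → U v u))
    ≡⟨ sumFin-+ (λ u → sumFin n (U u)) (λ u → sumFin n (λ v → U v u)) ⟩
  sumFin n (λ u → sumFin n (U u)) + sumFin n (λ u → sumFin n (λ v → U v u))
    ≡⟨ cong (sumFin n (λ u → sumFin n (U u)) +_) (sumFin-swap (λ u v → U v u)) ⟩
  sumFin n (λ u → sumFin n (U u)) + sumFin n (λ u → sumFin n (U u))
    ≡⟨ solve 1 (λ x → x :+ x := con 2ℚ :* x) refl (upperSum n F) ⟩
  2ℚ * upperSum n F ∎
  where
  open ≡-Reasoning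
  U : Fin n → Fin n → ℚ
  U u v = if toℕ u <ᵇ toℕ v then F u v else 0ℚ
  split : ∀ u v → F u v ≡ U u v + U v u
  split u v with toℕ u <ᵇ toℕ v | ℕₚ.<ᵇ-reflects-< (toℕ u) (toℕ v) | toℕ v <ᵇ toℕ u | ℕₚ.<ᵇ-reflects-< (toℕ v) (toℕ u)
  ... | true  | ofʸ u<v | true  | ofʸ v<u = contradiction v<u (ℕₚ.<-asym u<v)
  ... | true  | _       | false | _       = sym (+-identityʳ _)
  ... | false | _       | true  | _       = trans (F-sym u v) (sym (+-identityˡ _))
  ... | false | ofⁿ u≮v | false | ofⁿ v≮u = trans (cong (F u) (toℕ-injective (ℕₚ.≤-antisym (ℕₚ.≮⇒≥ u≮v) (ℕₚ.≮⇒≥ v≮u)))) (F-diag u)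

sumTo-* : ∀ k x (f : ℕ → ℚ) → sumTo k (λ i → x * f i) ≡ x * sumTo k f
sumTo-* zero    x f = sym (*-zeroʳ x)
sumTo-* (suc k) x f = trans (cong (_+ x * f (suc k)) (sumTo-* k x f)) (sym (*-distribˡ-+ x _ _))

sumFin-sumTo : ∀ {m} k (f : Fin m → ℕ → ℚ) → sumFin m (λ u → sumTo k (f u)) ≡ sumTo k (λ i → sumFin m (λ u → f u i))
sumFin-sumTo {m} zero    f = sumFin-zero m
sumFin-sumTo {m} (suc k) f = trans (sumFin-+ (λ u → sumTo k (f u)) (λ u → f u (suc k)))
  (cong (_+ sumFin m (λ u → f u (suc k))) (sumFin-sumTo k f))

sumTo-zero : ∀ k → sumTo k (λ _ → 0ℚ) ≡ 0ℚ
sumTo-zero zero    = refl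
sumTo-zero (suc k) = cong (_+ 0ℚ) (sumTo-zero k)

sumTo-append : ∀ a b (f : ℕ → ℚ) → sumTo (a ℕ.+ b) f ≡ sumTo a f + sumTo b (λ i → f (a ℕ.+ i))
sumTo-append a zero    f = trans (cong (λ z → sumTo z f) (ℕₚ.+-identityʳ a)) (sym (+-identityʳ _))
sumTo-append a (suc b) f = trans (cong (λ z → sumTo z f) (ℕₚ.+-suc a b))
  (trans (cong₂ _+_ (sumTo-append a b f) (cong f (sym (ℕₚ.+-suc a b)))) (+-assoc (sumTo a f) _ _))

-- The stripe permutation

-- Pigeonhole: if y were missed, punching it out of the codomain would inject n + 1 elements into n.
injective⇒surjective : ∀ {n} (f : Fin n → Fin n) → Injective _≡_ _≡_ f → ∀ y → ∃ λ x → f x ≡ y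
injective⇒surjective {suc n} f inj y with any? (λ x → f x Finₚ.≟ y)
... | yes p = p
... | no ¬p = contradiction (injective⇒≤ {f = λ x → punchOut (y≢f x)} (λ e → inj (punchOut-injective (y≢f _) (y≢f _) e))) ℕₚ.1+n≰n
  where
  y≢f : ∀ x → y ≢ f x
  y≢f x e = ¬p (x , sym e)

module StripePermutation (d : ℕ) (φ : ℕ → ℕ)
  (φ-range : ∀ i → 1 ℕ.≤ i → i ℕ.≤ d → (1 ℕ.≤ φ i) × (φ i ℕ.≤ d))
  (φ-injective : ∀ i j → 1 ℕ.≤ i → i ℕ.≤ d → 1 ℕ.≤ j → j ℕ.≤ d → φ i ≡ φ j → i ≡ j) where

  private
    1≤ : ∀ {k} → 1 ℕ.≤ suc k
    1≤ = ℕ.s≤s ℕ.z≤n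

    pred< : ∀ {k} → 1 ℕ.≤ k → k ℕ.≤ d → k ∸ 1 ℕ.< d
    pred< {suc k} _ k≤d = k≤d

    suc-pred : ∀ {k} → 1 ℕ.≤ k → suc (k ∸ 1) ≡ k
    suc-pred {suc k} _ = refl

    φ< : ∀ (i : Fin d) → φ (suc (toℕ i)) ∸ 1 ℕ.< d
    φ< i = let 1≤φ , φ≤d = φ-range (suc (toℕ i)) 1≤ (toℕ<n i) in pred< 1≤φ φ≤d

    f : Fin d → Fin d
    f i = fromℕ< (φ< i)

    suc-toℕ-f : ∀ i → suc (toℕ (f i)) ≡ φ (suc (toℕ i))
    suc-toℕ-f i = trans (cong suc (toℕ-fromℕ< (φ< i))) (suc-pred (proj₁ (φ-range (suc (toℕ i)) 1≤ (toℕ<n i))))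

    f-injective : Injective _≡_ _≡_ f
    f-injective {i} {j} e = toℕ-injective (ℕₚ.suc-injective (φ-injective _ _ 1≤ (toℕ<n i) 1≤ (toℕ<n j)
      (trans (sym (suc-toℕ-f i)) (trans (cong (suc ∘ toℕ) e) (suc-toℕ-f j)))))

    f⁻¹ : Fin d → Fin d
    f⁻¹ y = proj₁ (injective⇒surjective f f-injective y)

    f∘f⁻¹ : ∀ y → f (f⁻¹ y) ≡ y
    f∘f⁻¹ y = proj₂ (injective⇒surjective f f-injective y)

  φ-surjective : ∀ k → 1 ℕ.≤ k → k ℕ.≤ d → ∃ λ i → 1 ℕ.≤ i × i ℕ.≤ d × φ i ≡ k
  φ-surjective k 1≤k k≤d = let y = fromℕ< (pred< 1≤k k≤d) ; i = f⁻¹ y in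
    suc (toℕ i) , 1≤ , toℕ<n i ,
    trans (sym (suc-toℕ-f i)) (trans (cong (suc ∘ toℕ) (f∘f⁻¹ y)) (trans (cong suc (toℕ-fromℕ< (pred< 1≤k k≤d))) (suc-pred 1≤k)))

  sumTo-permute : ∀ (h : ℕ → ℚ) → sumTo d h ≡ sumTo d (λ i → h (φ i))
  sumTo-permute h = begin
    sumTo d h                                  ≡⟨ sumTo≡∑ d h ⟩
    sumFin d (λ i → h (suc (toℕ i)))           ≡⟨ sumFin≡sum {d} (λ i → h (suc (toℕ i))) ⟩
    _                                          ≡⟨ sum-permute (λ i → h (suc (toℕ i))) (permutation f f⁻¹ f∘f⁻¹ (λ x → f-injective (f∘f⁻¹ (f x)))) ⟩
    _                                          ≡⟨ sumFin≡sum (λ i → h (suc (toℕ (f i)))) ⟨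
    sumFin d (λ i → h (suc (toℕ (f i))))       ≡⟨ sumFin-cong (λ i → cong h (suc-toℕ-f i)) ⟩
    sumFin d (λ i → h (φ (suc (toℕ i))))       ≡⟨ sumTo≡∑ d (h ∘ φ) ⟨
    sumTo d (λ i → h (φ i))                    ∎
    where open ≡-Reasoning

  stripeIndex-φ : ∀ e → e ℕ.≤ d → ∀ i → 1 ℕ.≤ i → i ℕ.≤ e → stripeIndex e φ (φ i) ≡ i
  stripeIndex-φ zero    _   (suc i) _   ()
  stripeIndex-φ (suc e) e<d i       1≤i i≤1+e with φ (suc e) ≡ᵇ φ i | proof (φ (suc e) ℕₚ.≟ φ i)
  ... | true  | ofʸ eq = φ-injective (suc e) i 1≤ e<d 1≤i (ℕₚ.≤-trans i≤1+e e<d) eq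
  ... | false | ofⁿ ne = stripeIndex-φ e (ℕₚ.<⇒≤ e<d) i 1≤i (ℕₚ.≤-pred (ℕₚ.≤∧≢⇒< i≤1+e (λ e → ne (cong φ (sym e)))))

  -- No φ i is 0, so the search falls through to its default index 0, where `xValue` vanishes. This
  -- gives the diagonal the weight 0 that `row-sum` asks for.
  stripeIndex-0 : ∀ e → e ℕ.≤ d → stripeIndex e φ 0 ≡ 0
  stripeIndex-0 zero    _   = refl
  stripeIndex-0 (suc e) e<d with φ (suc e) | φ-range (suc e) 1≤ e<d
  ... | suc _ | _ = stripeIndex-0 e (ℕₚ.<⇒≤ e<d)

-- Feasibility and cost of the stripe solution

sumTo-Δ : ∀ n φ j → sumTo j (λ i → diffℚ (gSeq n φ (i ∸ 1)) (gSeq n φ i)) ≡ ℕtoℚ n - ℕtoℚ (gSeq n φ j)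
sumTo-Δ n φ zero    = sym (+-inverseʳ (ℕtoℚ n))
sumTo-Δ n φ (suc j) = trans (cong₂ _+_ (sumTo-Δ n φ j) (diffℚ≡ (gSeq n φ j) (gSeq n φ (suc j))))
  (solve 3 (λ a b c → (a :- b) :+ (b :- c) := a :- c) refl (ℕtoℚ n) (ℕtoℚ (gSeq n φ j)) (ℕtoℚ (gSeq n φ (suc j))))

module StripeSolution (n : ℕ) .{{_ : NonZero n}} (φ : ℕ → ℕ)
  (φ-range : ∀ i → 1 ℕ.≤ i → i ℕ.≤ n ℕ./ 2 → (1 ℕ.≤ φ i) × (φ i ℕ.≤ n ℕ./ 2))
  (φ-injective : ∀ i j → 1 ℕ.≤ i → i ℕ.≤ n ℕ./ 2 → 1 ℕ.≤ j → j ℕ.≤ n ℕ./ 2 → φ i ≡ φ j → i ≡ j)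
  (j : ℕ) (j<d : suc j ℕ.≤ n ℕ./ 2) where

  open StripePermutation (n ℕ./ 2) φ φ-range φ-injective public

  private
    d = n ℕ./ 2
    g = gSeq n φ
    ν = ℤ.+ 1 / n
    x = xSol n φ (suc j)

  X : ℕ → ℚ
  X k = xValue n φ (suc j) (stripeIndex d φ k)

  Δ : ℕ → ℚ
  Δ i = diffℚ (g (i ∸ 1)) (g i)

  X0≡0 : X 0 ≡ 0ℚ
  X0≡0 = cong (xValue n φ (suc j)) (stripeIndex-0 d ℕₚ.≤-refl)

  -- The doubled value on the stripe n/2 cancels against κ = ½, after which all stripes are treated
  -- alike.
  κ*half : ∀ i y → κ n i * ((if (i ℕ.* 2) ≡ᵇ n then 2ℚ else 1ℚ) * y) ≡ y
  κ*half i y with (i ℕ.* 2) ≡ᵇ n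
  ... | true  = solve 1 (λ y → con ½ :* (con 2ℚ :* y) := y) refl y
  ... | false = solve 1 (λ y → con 1ℚ :* (con 1ℚ :* y) := y) refl y

  weight-< : ∀ i → 1 ℕ.≤ i → i ℕ.≤ j → κ n (φ i) * xValue n φ (suc j) i ≡ ν * Δ i
  weight-< (suc i) _ i≤j with suc i <ᵇ suc j | ℕₚ.<ᵇ-reflects-< (suc i) (suc j)
  ... | true  | _      = trans (κ*half (φ (suc i)) _) (trans (/≡*1/ (ℤ.+ g i ℤ.- ℤ.+ g (suc i)) n) (*-comm (Δ (suc i)) ν))
  ... | false | ofⁿ ¬p = contradiction (ℕ.s≤s i≤j) ¬p

  weight-ℓ : κ n (φ (suc j)) * xValue n φ (suc j) (suc j) ≡ ν * ℕtoℚ (g j)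
  weight-ℓ with suc j <ᵇ suc j | ℕₚ.<ᵇ-reflects-< (suc j) (suc j) | suc j ≡ᵇ suc j | proof (suc j ℕₚ.≟ suc j)
  ... | true  | ofʸ p | _     | _      = contradiction p (ℕₚ.<-irrefl refl)
  ... | false | _     | true  | _      = trans (κ*half (φ (suc j)) _) (trans (/≡*1/ (ℤ.+ g j) n) (*-comm (ℕtoℚ (g j)) ν))
  ... | false | _     | false | ofⁿ ¬p = contradiction refl ¬p

  weight-> : ∀ i → suc j ℕ.< i → xValue n φ (suc j) i ≡ 0ℚ
  weight-> (suc i) j<i with suc i <ᵇ suc j | ℕₚ.<ᵇ-reflects-< (suc i) (suc j) | suc i ≡ᵇ suc j | proof (suc i ℕₚ.≟ suc j)
  ... | true  | ofʸ p | _     | _     = contradiction p (ℕₚ.<-asym j<i)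
  ... | false | _     | true  | ofʸ p = contradiction (sym p) (ℕₚ.<⇒≢ j<i)
  ... | false | _     | false | _     = refl

  -- Degree, cut and cost of the solution are all evaluated through this formula: the stripes are
  -- reindexed by φ, and those of index above ℓ = j + 1 have weight 0.
  stripe-sum : ∀ (Z : ℕ → ℚ) → sumTo d (λ k → κ n k * X k * Z k) ≡
    ν * (sumTo j (λ i → Δ i * Z (φ i)) + ℕtoℚ (g j) * Z (φ (suc j)))
  stripe-sum Z = begin
    sumTo d (λ k → κ n k * X k * Z k)
      ≡⟨ sumTo-permute (λ k → κ n k * X k * Z k) ⟩
    sumTo d (λ i → κ n (φ i) * X (φ i) * Z (φ i))
      ≡⟨ sumTo-cong d (λ i 1≤i i≤d → cong (λ z → κ n (φ i) * xValue n φ (suc j) z * Z (φ i)) (stripeIndex-φ d ℕₚ.≤-refl i 1≤i i≤d)) ⟩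
    sumTo d W
      ≡⟨ cong (λ z → sumTo z W) (ℕₚ.m+[n∸m]≡n j<d) ⟨
    sumTo (suc j ℕ.+ (d ∸ suc j)) W
      ≡⟨ sumTo-append (suc j) (d ∸ suc j) W ⟩
    (sumTo j W + W (suc j)) + sumTo (d ∸ suc j) (λ i → W (suc j ℕ.+ i))
      ≡⟨ cong₂ (λ a b → (a + b) + sumTo (d ∸ suc j) (λ i → W (suc j ℕ.+ i)))
           (trans (sumTo-cong j (λ i 1≤i i≤j → trans (cong (_* Z (φ i)) (weight-< i 1≤i i≤j)) (*-assoc ν (Δ i) (Z (φ i))))) (sumTo-* j ν _))
           (trans (cong (_* Z (φ (suc j))) weight-ℓ) (*-assoc ν (ℕtoℚ (g j)) (Z (φ (suc j))))) ⟩
    (ν * A + ν * B) + sumTo (d ∸ suc j) (λ i → W (suc j ℕ.+ i))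
      ≡⟨ cong ((ν * A + ν * B) +_) (trans (sumTo-cong (d ∸ suc j) (λ i 1≤i _ → tail i 1≤i)) (sumTo-zero (d ∸ suc j))) ⟩
    (ν * A + ν * B) + 0ℚ
      ≡⟨ trans (+-identityʳ _) (sym (*-distribˡ-+ ν A B)) ⟩
    ν * (A + B) ∎
    where
    open ≡-Reasoning
    W : ℕ → ℚ
    W i = κ n (φ i) * xValue n φ (suc j) i * Z (φ i)
    A = sumTo j (λ i → Δ i * Z (φ i))
    B = ℕtoℚ (g j) * Z (φ (suc j))
    tail : ∀ i → 1 ℕ.≤ i → W (suc j ℕ.+ i) ≡ 0ℚ
    tail i 1≤i = trans (cong (λ z → κ n (φ (suc j ℕ.+ i)) * z * Z (φ (suc j ℕ.+ i))) (weight-> (suc j ℕ.+ i) (ℕₚ.m<m+n (suc j) 1≤i)))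
      (solve 2 (λ k z → k :* con 0ℚ :* z := con 0ℚ) refl (κ n (φ (suc j ℕ.+ i))) (Z (φ (suc j ℕ.+ i))))

  x-sym : ∀ u v → x u v ≡ x v u
  x-sym u v = cong X (edgeLen-sym n u v)

  edgeVal-x : ∀ u v → edgeVal x u v ≡ x u v
  edgeVal-x u v with toℕ u <ᵇ toℕ v
  ... | true  = refl
  ... | false = x-sym v u

  x-diag : ∀ u → x u u ≡ 0ℚ
  x-diag u = trans (cong X (edgeLen-diag n u)) X0≡0

  ν*n : ∀ y → ν * (ℕtoℚ n * y) ≡ y
  ν*n y = trans (sym (*-assoc ν (ℕtoℚ n) y)) (trans (cong (_* y) (trans (*-comm ν (ℕtoℚ n)) (ℕtoℚ*1/ n))) (*-identityˡ y))

  x-degree : ∀ v → degree n x v ≡ 2ℚ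
  x-degree v = begin
    degree n x v
      ≡⟨ sumFin-cong entry ⟩
    sumFin n (λ u → X (edgeLen n v u) * 1ℚ)
      ≡⟨ row-sum n X (λ _ → 1ℚ) X0≡0 (λ _ → refl) v ⟩
    sumTo d (λ k → κ n k * X k * 2ℚ)
      ≡⟨ stripe-sum (λ _ → 2ℚ) ⟩
    ν * (sumTo j (λ i → Δ i * 2ℚ) + ℕtoℚ (g j) * 2ℚ)
      -- The differences telescope to n - g j, and the weight g j of stripe φ ℓ completes this to n.
      ≡⟨ cong (λ z → ν * (z + ℕtoℚ (g j) * 2ℚ)) (trans (sumTo-cong j (λ i _ _ → *-comm (Δ i) 2ℚ)) (trans (sumTo-* j 2ℚ Δ) (cong (2ℚ *_) (sumTo-Δ n φ j)))) ⟩
    ν * (2ℚ * (ℕtoℚ n - ℕtoℚ (g j)) + ℕtoℚ (g j) * 2ℚ)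
      ≡⟨ cong (ν *_) (solve 2 (λ n γ → con 2ℚ :* (n :- γ) :+ γ :* con 2ℚ := n :* con 2ℚ) refl (ℕtoℚ n) (ℕtoℚ (g j))) ⟩
    ν * (ℕtoℚ n * 2ℚ)
      ≡⟨ ν*n 2ℚ ⟩
    2ℚ ∎
    where
    open ≡-Reasoning
    entry : ∀ u → (if toℕ u ≡ᵇ toℕ v then 0ℚ else edgeVal x u v) ≡ X (edgeLen n v u) * 1ℚ
    entry u with toℕ u ≡ᵇ toℕ v | proof (toℕ u ℕₚ.≟ toℕ v)
    ... | true  | ofʸ e = sym (trans (*-identityʳ _) (trans (cong (x v) (toℕ-injective e)) (x-diag v)))
    ... | false | _     = trans (edgeVal-x u v) (trans (x-sym u v) (sym (*-identityʳ _)))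

  x-cut : g j ≢ 1 → g (suc j) ≡ 1 → (S : Fin n → Bool) → ∃ (λ v → S v ≡ true) → ∃ (λ v → S v ≡ false) → 2ℚ ≤ cut n x S
  x-cut g≢1 g≡1 S ∃∈ ∃∉ = begin
    2ℚ
      ≡⟨ ν*n 2ℚ ⟨
    ν * (ℕtoℚ n * 2ℚ)
      ≤⟨ *-monoˡ-≤ (0≤1/ n) (subst₂ _≤_ (*-comm 2ℚ (ℕtoℚ n)) refl (*-monoˡ-≤ (0≤ℕtoℚ 2) (boundary-bound φ j g≢1 g≡1 ∃∈ ∃∉))) ⟩
    ν * (2ℚ * (sumTo j (λ i → Δ i * boundary (φ i)) + ℕtoℚ (g j) * boundary (φ (suc j))))
      ≡⟨ cong (ν *_) (trans (*-distribˡ-+ 2ℚ (sumTo j (λ i → Δ i * boundary (φ i))) (ℕtoℚ (g j) * boundary (φ (suc j)))) (cong₂ _+_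
           (trans (sym (sumTo-* j 2ℚ (λ i → Δ i * boundary (φ i)))) (sumTo-cong j (λ i _ _ → 2*comm (Δ i) (boundary (φ i)))))
           (2*comm (ℕtoℚ (g j)) (boundary (φ (suc j)))))) ⟩
    ν * (sumTo j (λ i → Δ i * (2ℚ * boundary (φ i))) + ℕtoℚ (g j) * (2ℚ * boundary (φ (suc j))))
      ≡⟨ stripe-sum (λ k → 2ℚ * boundary k) ⟨
    sumTo d (λ k → κ n k * X k * (2ℚ * boundary k))
      ≡⟨ sumTo-cong d (λ k _ k≤d → sym (stripe k (ℕₚ.≤-trans k≤d (DivMod.m/n≤m n 2)))) ⟩
    sumTo d (λ k → sumFin n (λ u → κ n k * X k * (leaves (toℕ u) (toℕ u ℕ.+ k) + leaves (toℕ u) (toℕ u ℕ.+ (n ∸ k)))))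
      ≡⟨ sumFin-sumTo {n} d (λ u k → κ n k * X k * (leaves (toℕ u) (toℕ u ℕ.+ k) + leaves (toℕ u) (toℕ u ℕ.+ (n ∸ k)))) ⟨
    sumFin n (λ u → sumTo d (λ k → κ n k * X k * (leaves (toℕ u) (toℕ u ℕ.+ k) + leaves (toℕ u) (toℕ u ℕ.+ (n ∸ k)))))
      ≡⟨ sumFin-cong (λ u → sym (row-sum n X (leaves (toℕ u)) X0≡0 (leaves-per u) u)) ⟩
    sumFin n (λ u → sumFin n (λ v → X (edgeLen n u v) * leaves (toℕ u) (toℕ v)))
      ≡⟨ sumFin-cong (λ u → sumFin-cong (λ v → sym (entry u v))) ⟩
    cut n x S ∎
    where
    open ≤-Reasoning
    open Boundary n S
    2*comm : ∀ a b → 2ℚ * (a * b) ≡ a * (2ℚ * b)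
    2*comm = solve 2 (λ a b → con 2ℚ :* (a :* b) := a :* (con 2ℚ :* b)) refl
    leaves-per : ∀ u → Periodic n (leaves (toℕ u))
    leaves-per u v = cong (λ b → indicator (member (toℕ u) ∧ not b)) (member-periodic v)
    entry : ∀ u v → (if S u ∧ not (S v) then edgeVal x u v else 0ℚ) ≡ X (edgeLen n u v) * leaves (toℕ u) (toℕ v)
    entry u v = trans (lemma (S u ∧ not (S v)))
      (cong₂ _*_ (edgeVal-x u v) (cong₂ (λ a b → indicator (a ∧ not b)) (sym (member-toℕ u)) (sym (member-toℕ v))))
      where
      lemma : ∀ b {y} → (if b then y else 0ℚ) ≡ y * indicator b
      lemma true  {y} = sym (*-identityʳ y)
      lemma false {y} = sym (*-zeroʳ y)
    -- A step by n - k is a step back by k. Counted from u + k instead of u, it becomes an exit from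
    -- u + k to u, and `in≡out` applies.
    backward : ∀ k → k ℕ.≤ n → ∑ n (λ u → leaves u (u ℕ.+ (n ∸ k))) ≡ boundary k
    backward k k≤n = trans (sym (∑-shift (leaves-step-periodic (n ∸ k)) k))
      (trans (∑-cong n (λ u → trans (cong (leaves (u ℕ.+ k)) (trans (ℕₚ.+-assoc u k (n ∸ k)) (cong (u ℕ.+_) (ℕₚ.m+[n∸m]≡n k≤n))))
                                    (cong (λ b → indicator (member (u ℕ.+ k) ∧ not b)) (member-periodic u))))
             (in≡out k))
    stripe : ∀ k → k ℕ.≤ n → sumFin n (λ u → κ n k * X k * (leaves (toℕ u) (toℕ u ℕ.+ k) + leaves (toℕ u) (toℕ u ℕ.+ (n ∸ k)))) ≡ κ n k * X k * (2ℚ * boundary k)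
    stripe k k≤n = trans (sumFin-* {n} (κ n k * X k) _) (cong (κ n k * X k *_) (trans (sumFin-+ {n} _ _)
      (trans (cong (boundary k +_) (backward k k≤n)) (solve 1 (λ b → b :+ b := con 2ℚ :* b) refl (boundary k)))))

  -- As g ℓ = 1, the last summand (g (ℓ - 1) - 1) c (φ ℓ) and the extra c (φ ℓ) merge into g (ℓ - 1)
  -- c (φ ℓ).
  VDV≡ : ∀ c → g (suc j) ≡ 1 → VDV n c φ (suc j) ≡ sumTo j (λ i → Δ i * c (φ i)) + ℕtoℚ (g j) * c (φ (suc j))
  VDV≡ c g≡1 = sym (begin
    A + ℕtoℚ (g j) * cℓ
      ≡⟨ solve 3 (λ a γ c → a :+ γ :* c := (a :+ (γ :- con 1ℚ) :* c) :+ c) refl A (ℕtoℚ (g j)) cℓ ⟩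
    (A + (ℕtoℚ (g j) - 1ℚ) * cℓ) + cℓ
      ≡⟨ cong (λ z → (A + z * cℓ) + cℓ) (trans (cong (λ z → ℕtoℚ (g j) - ℕtoℚ z) (sym g≡1)) (sym (diffℚ≡ (g j) (g (suc j))))) ⟩
    VDV n c φ (suc j) ∎)
    where
    open ≡-Reasoning
    cℓ = c (φ (suc j))
    A = sumTo j (λ i → Δ i * c (φ i))

  x-cost : ∀ c → g (suc j) ≡ 1 → cost n c x ≡ VDV n c φ (suc j)
  x-cost c g≡1 = begin
    cost n c x
      -- Twice the sum over edges is a sum over ordered pairs, whose rows `row-sum` evaluates, all
      -- to the same value.
      ≡⟨ solve 1 (λ y → y := con ½ :* (con 2ℚ :* y)) refl (cost n c x) ⟩
    ½ * (2ℚ * cost n c x)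
      ≡⟨ cong (½ *_) (symmetric-sum n (λ u v → Y (edgeLen n u v)) (λ u v → cong Y (edgeLen-sym n u v)) (λ u → trans (cong Y (edgeLen-diag n u)) Y0≡0)) ⟨
    ½ * sumFin n (λ u → sumFin n (λ v → Y (edgeLen n u v)))
      ≡⟨ cong (½ *_) (sumFin-cong (λ u → trans (sumFin-cong (λ v → sym (*-identityʳ (Y (edgeLen n u v))))) (row-sum n Y (λ _ → 1ℚ) Y0≡0 (λ _ → refl) u))) ⟩
    ½ * sumFin n (λ u → sumTo d (λ k → κ n k * Y k * 2ℚ))
      ≡⟨ cong (½ *_) (sumFin-const n (sumTo d (λ k → κ n k * Y k * 2ℚ))) ⟩
    ½ * (ℕtoℚ n * sumTo d (λ k → κ n k * Y k * 2ℚ))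
      ≡⟨ cong (λ z → ½ * (ℕtoℚ n * z)) (trans (sumTo-cong d (λ k _ _ →
           solve 3 (λ κ c x → κ :* (c :* x) :* con 2ℚ := con 2ℚ :* (κ :* x :* c)) refl (κ n k) (c k) (X k)))
           (trans (sumTo-* d 2ℚ _) (cong (2ℚ *_) (stripe-sum c)))) ⟩
    ½ * (ℕtoℚ n * (2ℚ * (ν * (A + B))))
      ≡⟨ solve 3 (λ n ν c → con ½ :* (n :* (con 2ℚ :* (ν :* c))) := ν :* (n :* c)) refl (ℕtoℚ n) ν (A + B) ⟩
    ν * (ℕtoℚ n * (A + B))
      ≡⟨ ν*n (A + B) ⟩
    A + B
      ≡⟨ VDV≡ c g≡1 ⟨
    VDV n c φ (suc j) ∎
    where
    open ≡-Reasoning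
    Y : ℕ → ℚ
    Y k = c k * X k
    Y0≡0 : Y 0 ≡ 0ℚ
    Y0≡0 = trans (cong (c 0 *_) X0≡0) (*-zeroʳ (c 0))
    A = sumTo j (λ i → Δ i * c (φ i))
    B = ℕtoℚ (g j) * c (φ (suc j))

  scaled-bounds : ∀ m {P} → 0ℚ ≤ P → P ≤ ℕtoℚ n → (m ℕ.* 2 ≡ n → 2ℚ * P ≤ ℕtoℚ n) →
    let y = (if (m ℕ.* 2) ≡ᵇ n then 2ℚ else 1ℚ) * (P * ν) in (0ℚ ≤ y) × (y ≤ 1ℚ)
  scaled-bounds m {P} 0≤P P≤n 2P≤n with (m ℕ.* 2) ≡ᵇ n | proof (m ℕ.* 2 ℕₚ.≟ n)
  ... | true  | ofʸ e = 0≤*0≤ (0≤ℕtoℚ 2) (0≤*0≤ 0≤P (0≤1/ n)) ,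
    subst₂ _≤_ (solve 2 (λ P ν → ν :* (con 2ℚ :* P) := con 2ℚ :* (P :* ν)) refl P ν) (trans (cong (ν *_) (sym (*-identityʳ (ℕtoℚ n)))) (ν*n 1ℚ))
      (*-monoˡ-≤ (0≤1/ n) (2P≤n e))
  ... | false | _     = 0≤*0≤ 0≤1 (0≤*0≤ 0≤P (0≤1/ n)) ,
    subst₂ _≤_ (solve 2 (λ P ν → ν :* P := con 1ℚ :* (P :* ν)) refl P ν) (trans (cong (ν *_) (sym (*-identityʳ (ℕtoℚ n)))) (ν*n 1ℚ))
      (*-monoˡ-≤ (0≤1/ n) P≤n)

  proper-divisor-≤ : ∀ {m} → m ∣ n → m ≢ n → m ℕ.* 2 ℕ.≤ n
  proper-divisor-≤ (divides zero          n≡0) _   = contradiction n≡0 (ℕ.≢-nonZero⁻¹ n)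
  proper-divisor-≤ (divides 1             n≡m) m≢n = contradiction (sym (trans n≡m (ℕₚ.*-identityˡ _))) m≢n
  proper-divisor-≤ {m} (divides (suc (suc q)) e) _ = subst₂ ℕ._≤_ (ℕₚ.*-comm 2 m) (sym e) (ℕₚ.*-monoˡ-≤ m (ℕ.s≤s (ℕ.s≤s (ℕ.z≤n {q}))))

  2ℚ*ℕtoℚ : ∀ a → 2ℚ * ℕtoℚ a ≡ ℕtoℚ (a ℕ.* 2)
  2ℚ*ℕtoℚ a = trans (*-comm 2ℚ (ℕtoℚ a)) (sym (ℕtoℚ-homo-* a 2))

  half-stripe-∣ : ∀ i → φ (suc i) ℕ.* 2 ≡ n → g i ≡ n → φ (suc i) ∣ g (suc i)
  half-stripe-∣ i φ2≡n gi≡n = gcd-greatest ∣-refl (subst (φ (suc i) ∣_) (sym gi≡n) (divides 2 (trans (sym φ2≡n) (ℕₚ.*-comm (φ (suc i)) 2))))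

  g≤n : ∀ i → g i ℕ.≤ n
  g≤n i = ∣⇒≤ (gSeq-∣ n φ {0} {i} ℕ.z≤n)

  Δ≤g : ∀ i → Δ (suc i) ≤ ℕtoℚ (g i)
  Δ≤g i = subst₂ _≤_ (sym (diffℚ≡ (g i) (g (suc i)))) refl
    (0≤q-p⇒p≤q (subst (0ℚ ≤_) (solve 2 (λ a b → b := a :- (a :- b)) refl (ℕtoℚ (g i)) (ℕtoℚ (g (suc i)))) (0≤ℕtoℚ (g (suc i)))))

  -- The doubled value must stay at most 1. If g i ≠ n, it is a proper divisor of n, hence at most
  -- n/2. If g i = n, then φ (i + 1) = n/2 divides g (i + 1), so the difference is at most n/2.
  half-stripe-Δ : ∀ i → φ (suc i) ℕ.* 2 ≡ n → 2ℚ * Δ (suc i) ≤ ℕtoℚ n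
  half-stripe-Δ i φ2≡n with g i ℕₚ.≟ n
  ... | no gi≢n = ≤-trans (*-monoˡ-≤ (0≤ℕtoℚ 2) (Δ≤g i))
        (subst (_≤ ℕtoℚ n) (sym (2ℚ*ℕtoℚ (g i))) (ℕtoℚ-mono-≤ (proper-divisor-≤ (gSeq-∣ n φ {0} {i} ℕ.z≤n) gi≢n)))
  ... | yes gi≡n = begin
    2ℚ * Δ (suc i)
      ≡⟨ cong (2ℚ *_) (trans (diffℚ≡ (g i) (g (suc i))) (cong (λ z → ℕtoℚ z - γ′) gi≡n)) ⟩
    2ℚ * (ℕtoℚ n - γ′)
      ≡⟨ solve 2 (λ n γ → con 2ℚ :* (n :- γ) := n :+ (n :- con 2ℚ :* γ)) refl (ℕtoℚ n) γ′ ⟩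
    ℕtoℚ n + (ℕtoℚ n - 2ℚ * γ′)
      ≤⟨ +-monoʳ-≤ (ℕtoℚ n) (+-monoˡ-≤ (- (2ℚ * γ′)) (subst (ℕtoℚ n ≤_) (sym (2ℚ*ℕtoℚ (g (suc i)))) (ℕtoℚ-mono-≤ n≤2g))) ⟩
    ℕtoℚ n + (2ℚ * γ′ - 2ℚ * γ′)
      ≡⟨ trans (cong (ℕtoℚ n +_) (+-inverseʳ (2ℚ * γ′))) (+-identityʳ (ℕtoℚ n)) ⟩
    ℕtoℚ n ∎
    where
    open ≤-Reasoning
    γ′ = ℕtoℚ (g (suc i))
    n≤2g : n ℕ.≤ g (suc i) ℕ.* 2
    n≤2g = subst (ℕ._≤ g (suc i) ℕ.* 2) φ2≡n (ℕₚ.*-monoˡ-≤ 2 (∣⇒≤ {{gSeq-nonZero n φ (suc i)}} (half-stripe-∣ i φ2≡n gi≡n)))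

  -- Again g j is at most n/2 unless g j = n. In that case n/2 would divide g ℓ = 1, which forces n
  -- = 2.
  half-stripe-ℓ : 3 ℕ.≤ n → g (suc j) ≡ 1 → φ (suc j) ℕ.* 2 ≡ n → 2ℚ * ℕtoℚ (g j) ≤ ℕtoℚ n
  half-stripe-ℓ 3≤n g≡1 φ2≡n = subst (_≤ ℕtoℚ n) (sym (2ℚ*ℕtoℚ (g j)))
    (ℕtoℚ-mono-≤ (proper-divisor-≤ (gSeq-∣ n φ {0} {j} ℕ.z≤n) gj≢n))
    where
    gj≢n : g j ≢ n
    gj≢n gj≡n = ℕₚ.<-irrefl (trans (cong (ℕ._* 2) (sym (∣1⇒≡1 (subst (φ (suc j) ∣_) g≡1 (half-stripe-∣ j φ2≡n gj≡n))))) φ2≡n) 3≤n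

  xValue-bounds : 3 ℕ.≤ n → g (suc j) ≡ 1 → ∀ i → (0ℚ ≤ xValue n φ (suc j) i) × (xValue n φ (suc j) i ≤ 1ℚ)
  xValue-bounds 3≤n g≡1 zero = ≤-refl , 0≤1
  xValue-bounds 3≤n g≡1 (suc i) with suc i <ᵇ suc j | suc i ≡ᵇ suc j | proof (suc i ℕₚ.≟ suc j)
  ... | true  | _ | _ = subst (λ z → (0ℚ ≤ half * z) × (half * z ≤ 1ℚ)) (sym (/≡*1/ (ℤ.+ g i ℤ.- ℤ.+ g (suc i)) n))
    (scaled-bounds (φ (suc i)) (0≤diffℚ (gSeq-step-≤ n φ i)) (≤-trans (Δ≤g i) (ℕtoℚ-mono-≤ (g≤n i))) (half-stripe-Δ i))
    where half = if (φ (suc i) ℕ.* 2) ≡ᵇ n then 2ℚ else 1ℚ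
  ... | false | true  | ofʸ refl = subst (λ z → (0ℚ ≤ half * z) × (half * z ≤ 1ℚ)) (sym (/≡*1/ (ℤ.+ g j) n))
    (scaled-bounds (φ (suc j)) (0≤ℕtoℚ (g j)) (ℕtoℚ-mono-≤ (g≤n j)) (half-stripe-ℓ 3≤n g≡1))
    where half = if (φ (suc j) ℕ.* 2) ≡ᵇ n then 2ℚ else 1ℚ
  ... | false | false | _ = ≤-refl , 0≤1

  x-feasible : 3 ℕ.≤ n → g j ≢ 1 → g (suc j) ≡ 1 → SubtourFeasible n x
  x-feasible 3≤n g≢1 g≡1 = x-degree , x-cut g≢1 g≡1 , λ u v _ → xValue-bounds 3≤n g≡1 (stripeIndex d φ (edgeLen n u v))

-- The lower bound for feasible solutions

upperSum-mono : ∀ n {F G : Fin n → Fin n → ℚ} → (∀ u v → toℕ u ℕ.< toℕ v → F u v ≤ G u v) → upperSum n F ≤ upperSum n G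
upperSum-mono n {F} {G} F≤G = sumFin-mono (λ u → sumFin-mono (entry u))
  where
  entry : ∀ u v → (if toℕ u <ᵇ toℕ v then F u v else 0ℚ) ≤ (if toℕ u <ᵇ toℕ v then G u v else 0ℚ)
  entry u v with toℕ u <ᵇ toℕ v | ℕₚ.<ᵇ-reflects-< (toℕ u) (toℕ v)
  ... | true  | ofʸ u<v = F≤G u v u<v
  ... | false | _       = ≤-refl

upperSum-cong : ∀ n {F G : Fin n → Fin n → ℚ} → (∀ u v → toℕ u ℕ.< toℕ v → F u v ≡ G u v) → upperSum n F ≡ upperSum n G
upperSum-cong n F≡G = ≤-antisym (upperSum-mono n (λ u v u<v → ≤-reflexive (F≡G u v u<v)))
                                (upperSum-mono n (λ u v u<v → ≤-reflexive (sym (F≡G u v u<v))))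

upperSum-+ : ∀ n (F G : Fin n → Fin n → ℚ) → upperSum n (λ u v → F u v + G u v) ≡ upperSum n F + upperSum n G
upperSum-+ n F G = trans
  (sumFin-cong (λ u → trans (sumFin-cong {n} (λ v → if-+ (toℕ u <ᵇ toℕ v) {F u v} {G u v})) (sumFin-+ (λ v → if toℕ u <ᵇ toℕ v then F u v else 0ℚ) (λ v → if toℕ u <ᵇ toℕ v then G u v else 0ℚ))))
  (sumFin-+ (λ u → sumFin n (λ v → if toℕ u <ᵇ toℕ v then F u v else 0ℚ)) (λ u → sumFin n (λ v → if toℕ u <ᵇ toℕ v then G u v else 0ℚ)))
  where
  if-+ : ∀ b {x y} → (if b then x + y else 0ℚ) ≡ (if b then x else 0ℚ) + (if b then y else 0ℚ)
  if-+ true  = refl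
  if-+ false = refl

upperSum-* : ∀ n x (F : Fin n → Fin n → ℚ) → upperSum n (λ u v → x * F u v) ≡ x * upperSum n F
upperSum-* n x F = trans
  (sumFin-cong (λ u → trans (sumFin-cong {n} (λ v → if-* (toℕ u <ᵇ toℕ v) {F u v})) (sumFin-* x (λ v → if toℕ u <ᵇ toℕ v then F u v else 0ℚ))))
  (sumFin-* x (λ u → sumFin n (λ v → if toℕ u <ᵇ toℕ v then F u v else 0ℚ)))
  where
  if-* : ∀ b {y} → (if b then x * y else 0ℚ) ≡ x * (if b then y else 0ℚ)
  if-* true  = refl
  if-* false = sym (*-zeroʳ x)

upperSum-sumTo : ∀ n k (F : ℕ → Fin n → Fin n → ℚ) → upperSum n (λ u v → sumTo k (λ i → F i u v)) ≡ sumTo k (λ i → upperSum n (F i))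
upperSum-sumTo n zero    F = trans (upperSum-cong n (λ _ _ _ → sym (*-zeroˡ 0ℚ)))
  (trans (upperSum-* n 0ℚ (λ _ _ → 0ℚ)) (*-zeroˡ (upperSum n (λ _ _ → 0ℚ))))
upperSum-sumTo n (suc k) F = trans (upperSum-+ n (λ u v → sumTo k (λ i → F i u v)) (F (suc k)))
  (cong (_+ upperSum n (F (suc k))) (upperSum-sumTo n k F))

∑-δ : ∀ g a (f : ℕ → ℚ) → a ℕ.< g → ∑ g (λ r → if a ≡ᵇ r then f r else 0ℚ) ≡ f a
∑-δ (suc g) zero    f _           = trans (cong (f 0 +_) (sumFin-zero g)) (+-identityʳ (f 0))
∑-δ (suc g) (suc a) f (ℕ.s≤s a<g) = trans (+-identityˡ _) (∑-δ g a (f ∘ suc) a<g)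

≡ᵇ-refl : ∀ a → (a ≡ᵇ a) ≡ true
≡ᵇ-refl zero    = refl
≡ᵇ-refl (suc a) = ≡ᵇ-refl a

≡ᵇ-sym : ∀ a b → (a ≡ᵇ b) ≡ (b ≡ᵇ a)
≡ᵇ-sym zero    zero    = refl
≡ᵇ-sym zero    (suc b) = refl
≡ᵇ-sym (suc a) zero    = refl
≡ᵇ-sym (suc a) (suc b) = ≡ᵇ-sym a b

edgeVal-sym : ∀ {n} (y : Fin n → Fin n → ℚ) u v → toℕ u ≢ toℕ v → edgeVal y u v ≡ edgeVal y v u
edgeVal-sym y u v u≢v with toℕ u <ᵇ toℕ v | ℕₚ.<ᵇ-reflects-< (toℕ u) (toℕ v) | toℕ v <ᵇ toℕ u | ℕₚ.<ᵇ-reflects-< (toℕ v) (toℕ u)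
... | true  | ofʸ u<v | true  | ofʸ v<u = contradiction v<u (ℕₚ.<-asym u<v)
... | true  | _       | false | _       = refl
... | false | _       | true  | _       = refl
... | false | ofⁿ u≮v | false | ofⁿ v≮u = contradiction (ℕₚ.≤-antisym (ℕₚ.≮⇒≥ v≮u) (ℕₚ.≮⇒≥ u≮v)) u≢v

edgeVal-< : ∀ {n} (y : Fin n → Fin n → ℚ) u v → toℕ u ℕ.< toℕ v → edgeVal y u v ≡ y u v
edgeVal-< y u v u<v with toℕ u <ᵇ toℕ v | ℕₚ.<ᵇ-reflects-< (toℕ u) (toℕ v)
... | true  | _       = refl
... | false | ofⁿ u≮v = contradiction u<v u≮v

2*-cancel : ∀ {p q} → 2ℚ * p ≤ 2ℚ * q → p ≤ q
2*-cancel {p} {q} h = subst₂ _≤_ (half p) (half q) (*-monoˡ-≤ {½} (0≤1/ 2) h)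
  where
  half : ∀ p → ½ * (2ℚ * p) ≡ p
  half = solve 1 (λ p → con ½ :* (con 2ℚ :* p) := p) refl

module FeasibleBounds (n : ℕ) .{{_ : NonZero n}} (y : Fin n → Fin n → ℚ) (y-feasible : SubtourFeasible n y) where

  -- Handshake count: twice the total weight is the sum of the n degrees, each equal to 2.
  total : upperSum n y ≡ ℕtoℚ n
  total = ≤-antisym (2*-cancel (≤-reflexive 2T≡2n)) (2*-cancel (≤-reflexive (sym 2T≡2n)))
    where
    open ≡-Reasoning
    F : Fin n → Fin n → ℚ
    F v u = if toℕ u ≡ᵇ toℕ v then 0ℚ else edgeVal y u v
    F-sym : ∀ u v → F u v ≡ F v u
    F-sym u v rewrite ≡ᵇ-sym (toℕ u) (toℕ v) with toℕ v ≡ᵇ toℕ u | proof (toℕ v ℕₚ.≟ toℕ u)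
    ... | true  | _       = refl
    ... | false | ofⁿ v≢u = edgeVal-sym y v u v≢u
    F-diag : ∀ u → F u u ≡ 0ℚ
    F-diag u = cong (λ b → if b then 0ℚ else edgeVal y u u) (≡ᵇ-refl (toℕ u))
    F-< : ∀ u v → toℕ u ℕ.< toℕ v → y u v ≡ F u v
    F-< u v u<v = trans (sym (edgeVal-< y u v u<v)) (trans (edgeVal-sym y u v (ℕₚ.<⇒≢ u<v)) (lemma (toℕ v ≡ᵇ toℕ u) (proof (toℕ v ℕₚ.≟ toℕ u))))
      where
      lemma : ∀ b → Reflects (toℕ v ≡ toℕ u) b → edgeVal y v u ≡ (if b then 0ℚ else edgeVal y v u)
      lemma true  (ofʸ v≡u) = contradiction (sym v≡u) (ℕₚ.<⇒≢ u<v)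
      lemma false _         = refl
    2T≡2n : 2ℚ * upperSum n y ≡ 2ℚ * ℕtoℚ n
    2T≡2n = begin
      2ℚ * upperSum n y                     ≡⟨ cong (2ℚ *_) (upperSum-cong n F-<) ⟩
      2ℚ * upperSum n F                     ≡⟨ symmetric-sum n F F-sym F-diag ⟨
      sumFin n (λ v → degree n y v)         ≡⟨ sumFin-cong (proj₁ y-feasible) ⟩
      sumFin n (λ _ → 2ℚ)                   ≡⟨ sumFin-const n 2ℚ ⟩
      ℕtoℚ n * 2ℚ                           ≡⟨ *-comm (ℕtoℚ n) 2ℚ ⟩
      2ℚ * ℕtoℚ n                           ∎

  separated : (g : ℕ) .{{_ : NonZero g}} → Fin n → Fin n → Bool
  separated g u v = not (toℕ v DivMod.% g ≡ᵇ toℕ u DivMod.% g)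

  -- Every edge between distinct residue classes mod g lies in exactly two of the g cuts defined by the classes.
  separated-bound : ∀ g .{{_ : NonZero g}} → 2 ℕ.≤ g → g ℕ.≤ n →
    ℕtoℚ g ≤ upperSum n (λ u v → if separated g u v then y u v else 0ℚ)
  separated-bound g 2≤g g≤n = 2*-cancel (begin
    2ℚ * ℕtoℚ g
      ≡⟨ *-comm 2ℚ (ℕtoℚ g) ⟩
    ℕtoℚ g * 2ℚ
      ≡⟨ sumFin-const g 2ℚ ⟨
    sumFin g (λ _ → 2ℚ)
      ≤⟨ sumFin-mono (λ r → proj₁ (proj₂ y-feasible) (class (toℕ r)) (inhabited r) (coinhabited r)) ⟩
    ∑ g (λ r → cut n y (class r))
      ≡⟨ trans (sumFin-swap {g} {n} (λ r u → sumFin n (λ v → cutEntry (toℕ r) u v))) (sumFin-cong (λ u → sumFin-swap {g} {n} (λ r v → cutEntry (toℕ r) u v))) ⟩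
    sumFin n (λ u → sumFin n (λ v → ∑ g (λ r → cutEntry r u v)))
      -- For an ordered pair (u, v) only the class of u can contribute.
      ≡⟨ sumFin-cong (λ u → sumFin-cong (λ v → trans (∑-cong g (λ r → if-∧ (res u ≡ᵇ r) (not (res v ≡ᵇ r))))
           (∑-δ g (res u) (λ r → if not (res v ≡ᵇ r) then edgeVal y u v else 0ℚ) (m%n<n (toℕ u) g)))) ⟩
    sumFin n (λ u → sumFin n (λ v → F u v))
      ≡⟨ symmetric-sum n F F-sym F-diag ⟩
    2ℚ * upperSum n F
      ≡⟨ cong (2ℚ *_) (upperSum-cong n (λ u v u<v → cong (λ z → if separated g u v then z else 0ℚ) (edgeVal-< y u v u<v))) ⟩
    2ℚ * upperSum n (λ u v → if separated g u v then y u v else 0ℚ) ∎)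
    where
    open ≤-Reasoning
    res : Fin n → ℕ
    res u = toℕ u DivMod.% g
    class : ℕ → Fin n → Bool
    class r v = res v ≡ᵇ r
    cutEntry : ℕ → Fin n → Fin n → ℚ
    cutEntry r u v = if class r u ∧ not (class r v) then edgeVal y u v else 0ℚ
    F : Fin n → Fin n → ℚ
    F u v = if separated g u v then edgeVal y u v else 0ℚ
    if-∧ : ∀ a b {z : ℚ} → (if a ∧ b then z else 0ℚ) ≡ (if a then (if b then z else 0ℚ) else 0ℚ)
    if-∧ true  b = refl
    if-∧ false b = refl
    F-sym : ∀ u v → F u v ≡ F v u
    F-sym u v rewrite ≡ᵇ-sym (res u) (res v) with res v ≡ᵇ res u | proof (res v ℕₚ.≟ res u)
    ... | true  | _   = refl
    ... | false | ofⁿ ne = edgeVal-sym y u v (λ e → ne (cong (DivMod._% g) (sym e)))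
    F-diag : ∀ u → F u u ≡ 0ℚ
    F-diag u = cong (λ b → if not b then edgeVal y u u else 0ℚ) (≡ᵇ-refl (res u))
    residue : ∀ {r} → r ℕ.< g → ∃ λ v → res v ≡ r
    residue r<g = fromℕ< (ℕₚ.<-≤-trans r<g g≤n) , trans (cong (DivMod._% g) (toℕ-fromℕ< (ℕₚ.<-≤-trans r<g g≤n))) (m<n⇒m%n≡m r<g)
    inhabited : ∀ r → ∃ λ v → class (toℕ r) v ≡ true
    inhabited r = let v , e = residue (toℕ<n r) in v , trans (cong (_≡ᵇ toℕ r) e) (≡ᵇ-refl (toℕ r))
    coinhabited : ∀ (r : Fin g) → ∃ λ v → class (toℕ r) v ≡ false
    -- Class 0 misses the vertex with residue 1, which exists because 2 ≤ g; every other class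
    -- misses residue 0.
    coinhabited Fin.zero    = let v , e = residue 2≤g in v , cong (_≡ᵇ 0) e
    coinhabited r@(Fin.suc _) = let v , e = residue (ℕₚ.<-≤-trans ℕ.z<s 2≤g) in v , cong (_≡ᵇ toℕ r) e

edgeLen-range : ∀ n .{{_ : NonZero n}} (u v : Fin n) → toℕ u ℕ.< toℕ v → (1 ℕ.≤ edgeLen n u v) × (edgeLen n u v ℕ.≤ n ℕ./ 2)
edgeLen-range n u v u<v = subst (1 ℕ.≤_) (sym len≡) (ℕₚ.⊓-glb 1≤D (ℕₚ.m<n⇒0<n∸m D<n)) ,
  subst (ℕ._≤ n ℕ./ 2) (sym len≡) (*2≤⇒≤/2 (ℕₚ.≤-trans (ℕₚ.≤-reflexive (lemma (D ⊓ (n ∸ D))))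
    (ℕₚ.≤-trans (ℕₚ.+-mono-≤ (ℕₚ.m⊓n≤m D (n ∸ D)) (ℕₚ.m⊓n≤n D (n ∸ D))) (ℕₚ.≤-reflexive (ℕₚ.m+[n∸m]≡n (ℕₚ.<⇒≤ D<n))))))
  where
  D = ∣ toℕ u - toℕ v ∣
  D≡ : D ≡ toℕ v ∸ toℕ u
  D≡ = ℕₚ.m≤n⇒∣m-n∣≡n∸m (ℕₚ.<⇒≤ u<v)
  1≤D : 1 ℕ.≤ D
  1≤D = subst (1 ℕ.≤_) (sym D≡) (ℕₚ.m<n⇒0<n∸m u<v)
  D<n : D ℕ.< n
  D<n = subst (ℕ._< n) (sym D≡) (ℕₚ.≤-<-trans (ℕₚ.m∸n≤m (toℕ v) (toℕ u)) (toℕ<n v))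
  len≡ : edgeLen n u v ≡ D ⊓ (n ∸ D)
  len≡ = edgeLen≡ n u v
  lemma : ∀ k → k ℕ.* 2 ≡ k ℕ.+ k
  lemma = solve-∀
  *2≤⇒≤/2 : ∀ {k} → k ℕ.* 2 ℕ.≤ n → k ℕ.≤ n ℕ./ 2
  *2≤⇒≤/2 {k} h = subst (ℕ._≤ n ℕ./ 2) (DivMod.m*n/n≡m k 2) (DivMod./-monoˡ-≤ 2 h)

-- The length is D or n - D for the difference D of the endpoints, and as g divides n it divides D
-- in both cases.
∣edgeLen⇒≡% : ∀ n g .{{_ : NonZero g}} (u v : Fin n) → toℕ u ℕ.< toℕ v → g ∣ n → g ∣ edgeLen n u v →
  toℕ v DivMod.% g ≡ toℕ u DivMod.% g
∣edgeLen⇒≡% n g u v u<v g∣n g∣len with subst (g ∣_) D≡ g∣D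
  where
  D = ∣ toℕ u - toℕ v ∣
  D≡ : D ≡ toℕ v ∸ toℕ u
  D≡ = ℕₚ.m≤n⇒∣m-n∣≡n∸m (ℕₚ.<⇒≤ u<v)
  D≤n : D ℕ.≤ n
  D≤n = subst (ℕ._≤ n) (sym D≡) (ℕₚ.≤-trans (ℕₚ.m∸n≤m (toℕ v) (toℕ u)) (ℕₚ.<⇒≤ (toℕ<n v)))
  g∣D : g ∣ D
  g∣D with ℕₚ.⊓-sel D (n ∸ D)
  ... | inj₁ e = subst (g ∣_) (trans (edgeLen≡ n u v) e) g∣len
  ... | inj₂ e = ∣m+n∣m⇒∣n (subst (g ∣_) (sym (ℕₚ.m∸n+n≡m D≤n)) g∣n) (subst (g ∣_) (trans (edgeLen≡ n u v) e) g∣len)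
... | divides q e = trans (cong (DivMod._% g) (trans (sym (ℕₚ.m+[n∸m]≡n (ℕₚ.<⇒≤ u<v))) (cong (toℕ u ℕ.+_) e)))
                          (DivMod.[m+kn]%n≡m%n (toℕ u) q g)

-- Abel summation, applied to a = `gSeq n φ`, with a 0 = n, and b = `c ∘ φ`.
summation-by-parts : ∀ (a b : ℕ → ℚ) j →
  b 1 * a 0 + sumTo j (λ i → (b (suc i) - b i) * a i) ≡ sumTo j (λ i → (a (i ∸ 1) - a i) * b i) + a j * b (suc j)
summation-by-parts a b zero    = solve 2 (λ a b → b :* a :+ con 0ℚ := con 0ℚ :+ a :* b) refl (a 0) (b 1)
summation-by-parts a b (suc j) = begin
  b 1 * a 0 + (L + (b₂ - b₁) * a₁)
    ≡⟨ +-assoc (b 1 * a 0) L _ ⟨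
  (b 1 * a 0 + L) + (b₂ - b₁) * a₁
    ≡⟨ cong (_+ (b₂ - b₁) * a₁) (summation-by-parts a b j) ⟩
  (R + a₀ * b₁) + (b₂ - b₁) * a₁
    ≡⟨ solve 5 (λ R a₀ a₁ b₁ b₂ → (R :+ a₀ :* b₁) :+ (b₂ :- b₁) :* a₁ := (R :+ (a₀ :- a₁) :* b₁) :+ a₁ :* b₂) refl R a₀ a₁ b₁ b₂ ⟩
  (R + (a₀ - a₁) * b₁) + a₁ * b₂ ∎
  where
  open ≡-Reasoning
  a₀ = a j
  a₁ = a (suc j)
  b₁ = b (suc j)
  b₂ = b (suc (suc j))
  L = sumTo j (λ i → (b (suc i) - b i) * a i)
  R = sumTo j (λ i → (a (i ∸ 1) - a i) * b i)

module LowerBound (n : ℕ) .{{_ : NonZero n}} (c : ℕ → ℚ) (φ : ℕ → ℕ)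
  (φ-range : ∀ i → 1 ℕ.≤ i → i ℕ.≤ n ℕ./ 2 → (1 ℕ.≤ φ i) × (φ i ℕ.≤ n ℕ./ 2))
  (φ-injective : ∀ i j → 1 ℕ.≤ i → i ℕ.≤ n ℕ./ 2 → 1 ℕ.≤ j → j ℕ.≤ n ℕ./ 2 → φ i ≡ φ j → i ≡ j)
  (c-sorted : ∀ i j → 1 ℕ.≤ i → i ℕ.≤ j → j ℕ.≤ n ℕ./ 2 → c (φ i) ≤ c (φ j))
  (j : ℕ) (j<d : suc j ℕ.≤ n ℕ./ 2) (g≢1 : ∀ i → i ℕ.≤ j → gSeq n φ i ≢ 1)
  (y : Fin n → Fin n → ℚ) (y-feasible : SubtourFeasible n y) where

  open StripePermutation (n ℕ./ 2) φ φ-range φ-injective using (φ-surjective)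
  open FeasibleBounds n y y-feasible

  private
    g = gSeq n φ
    g-nonZero : ∀ i → NonZero (g i)
    g-nonZero i = gSeq-nonZero n φ i

    cross : ℕ → Fin n → Fin n → Bool
    cross i = separated (g i) {{g-nonZero i}}

  δ : ℕ → ℚ
  δ i = c (φ (suc i)) - c (φ i)

  0≤δ : ∀ i → 1 ℕ.≤ i → i ℕ.≤ j → 0ℚ ≤ δ i
  0≤δ i 1≤i i≤j = p≤q⇒0≤q-p (c-sorted i (suc i) 1≤i (ℕₚ.n≤1+n i) (ℕₚ.≤-trans (ℕ.s≤s i≤j) j<d))

  ρ : ℕ → Fin n → Fin n → ℚ
  ρ i u v = indicator (cross i u v)

  indicator≤1 : ∀ b → indicator b ≤ 1ℚ
  indicator≤1 true  = ≤-refl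
  indicator≤1 false = 0≤1

  -- The increments δ are nonnegative, so each indicator may be raised to 1; the sum then
  -- telescopes.
  telescope : ∀ u v e → e ℕ.≤ j → c (φ 1) + sumTo e (λ i → δ i * ρ i u v) ≤ c (φ (suc e))
  telescope u v zero    _   = ≤-reflexive (+-identityʳ (c (φ 1)))
  telescope u v (suc e) e<j = begin
    c (φ 1) + (sumTo e f + δ (suc e) * ρ (suc e) u v)
      ≡⟨ +-assoc (c (φ 1)) (sumTo e f) _ ⟨
    (c (φ 1) + sumTo e f) + δ (suc e) * ρ (suc e) u v
      ≤⟨ +-mono-≤ (telescope u v e (ℕₚ.<⇒≤ e<j)) (*-monoˡ-≤ (0≤δ (suc e) (ℕ.s≤s ℕ.z≤n) e<j) (indicator≤1 (cross (suc e) u v))) ⟩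
    c (φ (suc e)) + δ (suc e) * 1ℚ
      ≡⟨ solve 2 (λ a b → a :+ (b :- a) :* con 1ℚ := b) refl (c (φ (suc e))) (c (φ (suc (suc e)))) ⟩
    c (φ (suc (suc e))) ∎
    where
    open ≤-Reasoning
    f : ℕ → ℚ
    f i = δ i * ρ i u v

  -- An edge of stripe φ i stays inside a residue class mod g e for every e ≥ i.
  stripe-cost : ∀ u v → toℕ u ℕ.< toℕ v → ∀ i → 1 ℕ.≤ i → i ℕ.≤ n ℕ./ 2 → φ i ≡ edgeLen n u v →
    ∀ e → e ℕ.≤ j → c (φ 1) + sumTo e (λ i → δ i * ρ i u v) ≤ c (φ i)
  stripe-cost u v u<v i 1≤i i≤d φi≡len e e≤j with ℕₚ.<-≤-connex e i
  stripe-cost u v u<v i 1≤i i≤d φi≡len e e≤j | inj₁ e<i =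
    ≤-trans (telescope u v e e≤j) (c-sorted (suc e) i (ℕ.s≤s ℕ.z≤n) e<i i≤d)
  stripe-cost u v u<v i 1≤i i≤d φi≡len zero e≤j | inj₂ i≤0 = contradiction (ℕₚ.≤-trans 1≤i i≤0) λ ()
  -- The top term vanishes, so e is lowered until e < i, where sortedness of the costs finishes.
  stripe-cost u v u<v i 1≤i i≤d φi≡len (suc e) e<j | inj₂ i≤1+e = subst (_≤ c (φ i)) (cong (c (φ 1) +_) (sym drop))
    (stripe-cost u v u<v i 1≤i i≤d φi≡len e (ℕₚ.<⇒≤ e<j))
    where
    f : ℕ → ℚ
    f i = δ i * ρ i u v
    uᵣ = DivMod._%_ (toℕ u) (g (suc e)) {{g-nonZero (suc e)}}
    ρ≡0 : ρ (suc e) u v ≡ 0ℚ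
    ρ≡0 = cong (λ b → indicator (not b)) (trans (cong (_≡ᵇ uᵣ)
      (∣edgeLen⇒≡% n (g (suc e)) {{g-nonZero (suc e)}} u v u<v (gSeq-∣ n φ {0} {suc e} ℕ.z≤n) (subst (g (suc e) ∣_) φi≡len (gSeq-∣φ n φ 1≤i i≤1+e))))
      (≡ᵇ-refl uᵣ))
    drop : sumTo (suc e) f ≡ sumTo e f
    drop = trans (cong (λ z → sumTo e f + δ (suc e) * z) ρ≡0) (trans (cong (sumTo e f +_) (*-zeroʳ (δ (suc e)))) (+-identityʳ _))

  cost-bound : sumTo j (λ i → diffℚ (g (i ∸ 1)) (g i) * c (φ i)) + ℕtoℚ (g j) * c (φ (suc j)) ≤ cost n c y
  cost-bound = begin
    sumTo j (λ i → diffℚ (g (i ∸ 1)) (g i) * c (φ i)) + ℕtoℚ (g j) * c (φ (suc j))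
      ≡⟨ cong (_+ ℕtoℚ (g j) * c (φ (suc j))) (sumTo-cong j (λ i _ _ → cong (_* c (φ i)) (diffℚ≡ (g (i ∸ 1)) (g i)))) ⟩
    sumTo j (λ i → (ℕtoℚ (g (i ∸ 1)) - ℕtoℚ (g i)) * c (φ i)) + ℕtoℚ (g j) * c (φ (suc j))
      ≡⟨ summation-by-parts (ℕtoℚ ∘ g) (c ∘ φ) j ⟨
    c (φ 1) * ℕtoℚ n + sumTo j (λ i → δ i * ℕtoℚ (g i))
      -- The cuts by residue classes are available since g i divides n and is not 1, so 2 ≤ g i ≤ n.
      ≤⟨ +-monoʳ-≤ (c (φ 1) * ℕtoℚ n) (sumTo-mono j (λ i 1≤i i≤j → *-monoˡ-≤ (0≤δ i 1≤i i≤j)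
           (separated-bound (g i) {{g-nonZero i}} (ℕₚ.≤∧≢⇒< (ℕ.>-nonZero⁻¹ (g i) {{g-nonZero i}}) (λ e → g≢1 i i≤j (sym e))) (∣⇒≤ (gSeq-∣ n φ {0} {i} ℕ.z≤n))))) ⟩
    c (φ 1) * ℕtoℚ n + sumTo j (λ i → δ i * upperSum n (λ u v → if cross i u v then y u v else 0ℚ))
      ≡⟨ cong₂ _+_ (trans (cong (c (φ 1) *_) (sym total)) (sym (upperSum-* n (c (φ 1)) y)))
           (trans (sumTo-cong j (λ i _ _ → trans (sym (upperSum-* n (δ i) (λ u v → if cross i u v then y u v else 0ℚ)))
                                                 (upperSum-cong n (λ u v _ → entry i u v))))
                  (sym (upperSum-sumTo n j (λ i u v → y u v * (δ i * ρ i u v))))) ⟩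
    upperSum n (λ u v → c (φ 1) * y u v) + upperSum n (λ u v → sumTo j (λ i → y u v * (δ i * ρ i u v)))
      ≡⟨ upperSum-+ n (λ u v → c (φ 1) * y u v) (λ u v → sumTo j (λ i → y u v * (δ i * ρ i u v))) ⟨
    upperSum n (λ u v → c (φ 1) * y u v + sumTo j (λ i → y u v * (δ i * ρ i u v)))
      -- Edge by edge: `φ-surjective` finds the index of the stripe of the edge, and `stripe-cost`
      -- is multiplied by the nonnegative value of y.
      ≤⟨ upperSum-mono n (λ u v u<v → let i , 1≤i , i≤d , φi≡len = φ-surjective (edgeLen n u v) (proj₁ (edgeLen-range n u v u<v)) (proj₂ (edgeLen-range n u v u<v)) in
           subst₂ _≤_ (trans (*-distribˡ-+ (y u v) (c (φ 1)) _) (cong₂ _+_ (*-comm (y u v) (c (φ 1))) (sym (sumTo-* j (y u v) (λ i → δ i * ρ i u v)))))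
             (trans (*-comm (y u v) (c (φ i))) (cong (λ k → c k * y u v) φi≡len))
             (*-monoˡ-≤ (proj₁ (proj₂ (proj₂ y-feasible) u v u<v)) (stripe-cost u v u<v i 1≤i i≤d φi≡len j ℕₚ.≤-refl))) ⟩
    cost n c y ∎
    where
    open ≤-Reasoning
    entry : ∀ i u v → δ i * (if cross i u v then y u v else 0ℚ) ≡ y u v * (δ i * ρ i u v)
    entry i u v with cross i u v
    ... | true  = solve 2 (λ d y → d :* y := y :* (d :* con 1ℚ)) refl (δ i) (y u v)
    ... | false = solve 2 (λ d y → d :* con 0ℚ := y :* (d :* con 0ℚ)) refl (δ i) (y u v)

-- Equality with the optimal value is expressed by attainment: the given vector is feasible, no
-- feasible vector is cheaper, and its cost is `VDV`.
theorem3 : (n : ℕ) .{{_ : NonZero n}} → 3 ℕ.≤ n →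
    (c : ℕ → ℚ) → (∀ k → 1 ℕ.≤ k → k ℕ.≤ n ℕ./ 2 → 0ℚ ℚ.≤ c k) →
    (φ : ℕ → ℕ) →
    (∀ i → 1 ℕ.≤ i → i ℕ.≤ n ℕ./ 2 → (1 ℕ.≤ φ i) × (φ i ℕ.≤ n ℕ./ 2)) →
    (∀ i j → 1 ℕ.≤ i → i ℕ.≤ n ℕ./ 2 → 1 ℕ.≤ j → j ℕ.≤ n ℕ./ 2 → φ i ≡ φ j → i ≡ j) →
    (∀ i j → 1 ℕ.≤ i → i ℕ.≤ j → j ℕ.≤ n ℕ./ 2 → c (φ i) ℚ.≤ c (φ j)) →
    (ℓ : ℕ) → 1 ℕ.≤ ℓ → ℓ ℕ.≤ n ℕ./ 2 → gSeq n φ ℓ ≡ 1 →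
    (∀ i → 1 ℕ.≤ i → i ℕ.< ℓ → gSeq n φ i ≢ 1) →
    SubtourFeasible n (xSol n φ ℓ) ×
    (∀ (y : Fin n → Fin n → ℚ) → SubtourFeasible n y →
    cost n c (xSol n φ ℓ) ℚ.≤ cost n c y) ×
    (cost n c (xSol n φ ℓ) ≡ VDV n c φ ℓ)
theorem3 n 3≤n c _ φ φ-range φ-injective c-sorted (suc j) _ j<d g≡1 g≢1 =
  x-feasible 3≤n (g≢1′ j ℕₚ.≤-refl) g≡1 ,
  (λ y y-feasible → subst (_≤ cost n c y) (sym (trans (x-cost c g≡1) (VDV≡ c g≡1)))
    (LowerBound.cost-bound n c φ φ-range φ-injective c-sorted j j<d g≢1′ y y-feasible)) ,
  x-cost c g≡1
  where
  open StripeSolution n φ φ-range φ-injective j j<d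
  g≢1′ : ∀ i → i ℕ.≤ j → gSeq n φ i ≢ 1
  -- Minimality of ℓ speaks of i ≥ 1 only; for i = 0 the term is n, which is at least 3.
  g≢1′ zero    _   n≡1 = contradiction (subst (3 ℕ.≤_) n≡1 3≤n) λ { (ℕ.s≤s ()) }
  g≢1′ (suc i) i<j     = g≢1 (suc i) (ℕ.s≤s ℕ.z≤n) (ℕ.s≤s i<j)
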